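{- If $T$ is a tree with $k$ edges, then $\pi_k^{\ast}(T) \leq \pi_k^{\ast}(K_{1, k}) = \left(\frac{k-1}{k}\right)^2$, where $K_{1,k}$ is the star with $k$ edges.
   Context: A graph system of order $k$ on a vertex set $V$ is a tuple $\mathcal{G}=(G_1,\dots,G_k)$ of simple graphs on the common vertex set $V$. A graph $H$ with $V(H)\subseteq V$ is a rainbow subgraph of $\mathcal{G}$ if there is an injective map $\psi:E(H)\to[k]$ with $e\in E(G_{\psi(e)})$ for every $e\in E(H)$; $\mathcal{G}$ is rainbow $H$-free if it has no rainbow subgraph isomorphic to $H$. $\mathrm{ex}_k^{\ast}(n,H)$ is the maximum of $\min_{1\le i\le k}|E(G_i)|$ over all rainbow $H$-free graph systems $(G_1,\dots,G_k)$ on $[n]$, and $\pi_k^{\ast}(H)=\lim_{n\to\infty}\mathrm{ex}_k^{\ast}(n,H)/\binom{n}{2}$ (this limit exists). -}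

module Defs where

open import Data.Nat as ℕ using (ℕ; zero; suc; NonZero; _∸_)
open import Data.Nat.Combinatorics using (_C_)
open import Data.Integer using (+_)
open import Data.Rational as ℚ using (ℚ; _/_)
open import Data.Fin as Fin using (Fin; toℕ; inject₁; fromℕ)
import Data.Bool
open import Data.Bool using (Bool; true; false)
import Data.List
open import Data.List using (List; []; _∷_; filter; length)
open import Data.List.Base using (concatMap)
open import Data.Product using (Σ; _×_; ∃; ∃-syntax; _,_)
open import Relation.Binary.PropositionalEquality using (_≡_)
open import Relation.Nullary using (¬_)
open import Relation.Nullary.Decidable using (⌊_⌋)
open import Function.Definitions using (Injective)
open import Data.List using (allFin)

record SimpleGraph (n : ℕ) : Set where
  field
    adj   : Fin n → Fin n → Bool
    sym   : ∀ u v → adj u v ≡ adj v u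
    irrefl : ∀ u → adj u u ≡ false
open SimpleGraph public

_∼[_]_ : ∀ {n} → Fin n → SimpleGraph n → Fin n → Set
u ∼[ G ] v = adj G u v ≡ true

edgeList : ∀ {n} → SimpleGraph n → List (Fin n × Fin n)
edgeList {n} G =
  filter (λ { (u , v) → ⌊ toℕ u ℕ.<? toℕ v ⌋ Data.Bool.∧ adj G u v Data.Bool.≟ true })
         (concatMap (λ u → Data.List.map (λ v → (u , v)) (allFin n)) (allFin n))
  where open import Data.Bool using (_∧_; _≟_)
        open import Data.List using (map)

edgeCount : ∀ {n} → SimpleGraph n → ℕ
edgeCount G = length (edgeList G)

data Walk {m : ℕ} (G : SimpleGraph m) : Fin m → Fin m → Set where
  here : ∀ {u} → Walk G u u
  step : ∀ {u v w} → u ∼[ G ] v → Walk G v w → Walk G u w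

Connected : ∀ {m} → SimpleGraph m → Set
Connected G = ∀ u v → Walk G u v

record Cycle {m : ℕ} (G : SimpleGraph m) : Set where
  field
    j     : ℕ
    f     : Fin (suc (suc (suc j))) → Fin m
    f-inj : Injective _≡_ _≡_ f
    f-adj : ∀ (i : Fin (suc (suc j))) → f (inject₁ i) ∼[ G ] f (Fin.suc i)
    f-close : f (fromℕ (suc (suc j))) ∼[ G ] f Fin.zero

Acyclic : ∀ {m} → SimpleGraph m → Set
Acyclic G = ¬ Cycle G

IsTree : ∀ {m} → SimpleGraph m → Set
IsTree G = Connected G × Acyclic G

isZero : ∀ {m} → Fin m → Bool
isZero Fin.zero = true
isZero (Fin.suc _) = false

star : (k : ℕ) → SimpleGraph (suc k)
star k = record
  { adj = λ u v → isZero u Data.Bool.xor isZero v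
  ; sym = λ u v → xor-comm (isZero u) (isZero v)
  ; irrefl = λ u → xor-self (isZero u) }
  where
  open import Data.Bool using (_xor_)
  open import Relation.Binary.PropositionalEquality using (refl)
  xor-comm : ∀ a b → (a Data.Bool.xor b) ≡ (b Data.Bool.xor a)
  xor-comm true true = refl
  xor-comm true false = refl
  xor-comm false true = refl
  xor-comm false false = refl
  xor-self : ∀ a → (a Data.Bool.xor a) ≡ false
  xor-self true = refl
  xor-self false = refl

GraphSystem : ℕ → ℕ → Set
GraphSystem k n = Fin k → SimpleGraph n

-- 𝒢 contains a rainbow copy of H (H on vertex set Fin m): an injective
-- vertex map φ and an injective colouring ψ of the edges of H by [k] such
-- that the image of each edge e of H is an edge of G_{ψ(e)}.
-- Edges of H are represented by pairs (u , v) with toℕ u < toℕ v.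
record RainbowCopy {k n m : ℕ} (𝒢 : GraphSystem k n) (H : SimpleGraph m) : Set where
  field
    φ     : Fin m → Fin n
    φ-inj : Injective _≡_ _≡_ φ
    ψ     : Fin m → Fin m → Fin k
    ψ-ok  : ∀ u v → toℕ u ℕ.< toℕ v → u ∼[ H ] v → φ u ∼[ 𝒢 (ψ u v) ] φ v
    ψ-inj : ∀ u v u' v' → toℕ u ℕ.< toℕ v → u ∼[ H ] v →
                          toℕ u' ℕ.< toℕ v' → u' ∼[ H ] v' →
                          ψ u v ≡ ψ u' v' → (u ≡ u') × (v ≡ v')

RainbowFree : ∀ {k n m} → GraphSystem k n → SimpleGraph m → Set
RainbowFree 𝒢 H = ¬ RainbowCopy 𝒢 H

toℚ : ℕ → ℚ
toℚ a = + a / 1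

-- ex*_k(n,H) ≤ x · C(n,2)  (every rainbow H-free system has min_i |E(G_i)| ≤ x·C(n,2))
ExAtMost : (k n : ℕ) → ∀ {m} → SimpleGraph m → ℚ → Set
ExAtMost k n H x = (𝒢 : GraphSystem k n) → RainbowFree 𝒢 H →
  ∃[ i ] (toℚ (edgeCount (𝒢 i)) ℚ.≤ x ℚ.* toℚ (n C 2))

-- ex*_k(n,H) ≥ x · C(n,2)  (some rainbow H-free system has min_i |E(G_i)| ≥ x·C(n,2))
ExAtLeast : (k n : ℕ) → ∀ {m} → SimpleGraph m → ℚ → Set
ExAtLeast k n H x = ∃[ 𝒢 ] (RainbowFree {k} {n} 𝒢 H ×
  (∀ i → x ℚ.* toℚ (n C 2) ℚ.≤ toℚ (edgeCount (𝒢 i))))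

-- π*_k(H) ≤ c   (given that the limit exists):  ∀ ε > 0, eventually ex/C(n,2) ≤ c + ε
TuranDensityAtMost : (k : ℕ) → ∀ {m} → SimpleGraph m → ℚ → Set
TuranDensityAtMost k H c =
  ∀ (ε : ℚ) → ℚ.0ℚ ℚ.< ε → ∃[ N ] (∀ n → N ℕ.≤ n → ExAtMost k n H (c ℚ.+ ε))

TuranDensityEq : (k : ℕ) → ∀ {m} → SimpleGraph m → ℚ → Set
TuranDensityEq k H c =
  ∀ (ε : ℚ) → ℚ.0ℚ ℚ.< ε → ∃[ N ] (∀ n → N ℕ.≤ n →
     ExAtMost k n H (c ℚ.+ ε) × ExAtLeast k n H (c ℚ.- ε))

starDensity : (k : ℕ) → .{{NonZero k}} → ℚ
starDensity k = ((+ (k ∸ 1)) / k) ℚ.* ((+ (k ∸ 1)) / k)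

module Submission where

-- Write κ = (k-1)/k, and call a colour low at x in W if x has boundedly many neighbours of that colour in W.
-- Delete, as long as possible, a vertex with two low colours in the current set W. Each deletion removes about
-- 4|W| non-edges (summed over the colours), as much as 2|W|² decreases, so the initial excess
-- 2n² - (number of non-edges) > n²/k survives. In the final W each vertex has at most one low colour.
-- Some y in W has no low colour in the whole graph: otherwise the sets Aᵢ where colour i is low partition W, forcing
-- 2|W|² - Σ|Aᵢ|² non-edges, hence Σ|Aᵢ|² > n²/k, while |Aᵢ| ≤ n/k because Gᵢ has more than κ²n²/2 edges.
-- Remove from T a leaf at a vertex t. Starting with t at y, T minus the leaf embeds greedily into W: two colours are
-- always unused and only one can be low. The leaf is attached at y with the last colour.
-- For the star, the cliques on the complements of k parts of size about n/k show optimality.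

open import Defs renaming (sym to adj-sym; irrefl to adj-irrefl)
open import Data.Bool using (Bool; true; false; not; _∧_; _∨_; if_then_else_)
import Data.Bool as Bool
open import Data.Nat using (ℕ; zero; suc; _+_; _*_; _∸_; _≤_; _<_; z≤n; s≤s; NonZero; _≤?_; _<?_)
open import Data.Nat.Properties
open import Algebra.Properties.Semiring.Sum +-*-semiring
open import Data.Nat.Tactic.RingSolver using (solve-∀)
open import Data.Fin using (Fin; toℕ; inject₁; fromℕ; fromℕ<)
import Data.Fin as Fin
import Data.Fin.Properties as Fin
open import Data.Product using (Σ; _×_; _,_; proj₁; proj₂; ∃-syntax)
open import Data.Sum using (_⊎_; inj₁; inj₂)
open import Data.Empty using (⊥; ⊥-elim)
open import Function using (_∘_; id)
open import Relation.Nullary using (¬_; Dec; yes; no; does; contradiction)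
open import Relation.Nullary.Decidable using (⌊_⌋; dec-true; dec-false; _×-dec_; ¬?)
open import Relation.Binary.PropositionalEquality using (_≡_; _≢_; refl; sym; trans; cong; cong₂; subst; subst₂; module ≡-Reasoning)
import Data.List as List
import Data.List.Properties as List
import Data.Nat.ListAction as ListAction
import Data.Nat.ListAction.Properties as ListAction
open import Relation.Unary using (Decidable)
import Data.Integer as ℤ
import Data.Integer.Properties as ℤ
import Data.Integer.Tactic.RingSolver as ℤSolver
open import Data.Rational using (ℚ; mkℚ)
import Data.Rational as ℚ
import Data.Rational.Properties as ℚ
open import Data.Rational.Unnormalised using (mkℚᵘ)
import Data.Rational.Unnormalised as ℚᵘ
import Data.Rational.Unnormalised.Properties as ℚᵘ
open import Data.Nat.Combinatorics using (_C_; nC1≡n; nCk+nC[k+1]≡[n+1]C[k+1])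
open import Data.Nat.DivMod using (_/_; _%_; _mod_; m%n<n; m≡m%n+[m/n]*n; m/n*n≤m; /-mono-≤)
open import Data.Bool.Properties using (∧-comm)

-- The obstacle is the last edge. So the vertex carrying the last edge must be rich in every colour,
-- and the embedding starts there. Richness in the whole graph is enough, because the leaf may lie
-- outside W. The constant comes from counting ordered non-adjacent pairs, diagonal included.
-- Density κ² leaves at most about (1 - κ²)n² = (2k-1)n²/k² of them per colour, hence 2n² - n²/k
-- over k colours. The final comparison is tight at leading order: |Aᵢ| ≤ n/k gives Σ|Aᵢ|² ≤ |W|n/k
-- ≤ n²/k. The linear error terms carried by `Dense` and `EdgeDense` pay for the low degrees, and
-- their unspent half makes the contradiction strict.

private variable
  k m n : ℕ

-- Finite sums and subsets

⟦_⟧ : Bool → ℕ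
⟦ true ⟧ = 1
⟦ false ⟧ = 0

⟦_⟧≤1 : ∀ b → ⟦ b ⟧ ≤ 1
⟦ true ⟧≤1 = ≤-refl
⟦ false ⟧≤1 = z≤n

does⇒ : {P : Set} (d : Dec P) → does d ≡ true → P
does⇒ (yes p) _ = p

_==_ : Fin n → Fin n → Bool
i == j = does (i Fin.≟ j)

==-refl : (i : Fin n) → i == i ≡ true
==-refl i = dec-true (i Fin.≟ i) refl

≢⇒== : {i j : Fin n} → i ≢ j → i == j ≡ false
≢⇒== {i = i} {j} i≢j = dec-false (i Fin.≟ j) i≢j

==⇒≡ : {i j : Fin n} → i == j ≡ true → i ≡ j
==⇒≡ {i = i} {j} = does⇒ (i Fin.≟ j)

true≢false : ∀ {b} → b ≡ true → b ≢ false
true≢false refl ()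

≢true⇒false : ∀ {b} → b ≢ true → b ≡ false
≢true⇒false {true} h = contradiction refl h
≢true⇒false {false} _ = refl

sum-mono-≤ : {f g : Fin n → ℕ} → (∀ i → f i ≤ g i) → sum f ≤ sum g
sum-mono-≤ {zero} h = z≤n
sum-mono-≤ {suc n} h = +-mono-≤ (h Fin.zero) (sum-mono-≤ (h ∘ Fin.suc))

sum-const : ∀ n c → ∑[ i < n ] c ≡ n * c
sum-const zero c = refl
sum-const (suc n) c = cong (c +_) (sum-const n c)

sum-zero : {f : Fin n → ℕ} → (∀ i → f i ≡ 0) → sum f ≡ 0
sum-zero {n} h = trans (sum-cong-≗ {n} h) (trans (sum-const n 0) (*-zeroʳ n))

term≤sum : (f : Fin n → ℕ) (i : Fin n) → f i ≤ sum f
term≤sum f Fin.zero = m≤m+n _ _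
term≤sum f (Fin.suc i) = ≤-trans (term≤sum (f ∘ Fin.suc) i) (m≤n+m _ _)

two-terms≤sum : (f : Fin n → ℕ) {i j : Fin n} → i ≢ j → f i + f j ≤ sum f
two-terms≤sum f {Fin.zero} {Fin.zero} i≢j = contradiction refl i≢j
two-terms≤sum f {Fin.zero} {Fin.suc j} i≢j = +-monoʳ-≤ (f Fin.zero) (term≤sum (f ∘ Fin.suc) j)
two-terms≤sum f {Fin.suc i} {Fin.zero} i≢j =
  ≤-trans (≤-reflexive (+-comm (f (Fin.suc i)) _)) (+-monoʳ-≤ (f Fin.zero) (term≤sum (f ∘ Fin.suc) i))
two-terms≤sum f {Fin.suc i} {Fin.suc j} i≢j =
  ≤-trans (two-terms≤sum (f ∘ Fin.suc) (i≢j ∘ cong Fin.suc)) (m≤n+m _ _)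

sum-pick : (x : Fin n) (f : Fin n → ℕ) → ∑[ v < n ] (⟦ v == x ⟧ * f v) ≡ f x
sum-pick {suc n} Fin.zero f =
  trans (cong₂ _+_ (+-identityʳ _) (sum-zero {n} λ _ → refl)) (+-identityʳ _)
sum-pick {suc n} (Fin.suc x) f = trans (sum-cong-≗ {n} unshift) (sum-pick x (f ∘ Fin.suc))
  where
  unshift : ∀ v → ⟦ Fin.suc v == Fin.suc x ⟧ * f (Fin.suc v) ≡ ⟦ v == x ⟧ * f (Fin.suc v)
  unshift v with v Fin.≟ x
  ... | yes _ = refl
  ... | no _ = refl

∣_∣ : (Fin n → Bool) → ℕ
∣ P ∣ = sum (λ v → ⟦ P v ⟧)

∣∣-singleton : (x : Fin n) → ∣ (_== x) ∣ ≡ 1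
∣∣-singleton {n} x = trans (sum-cong-≗ {n} λ v → sym (*-identityʳ ⟦ v == x ⟧)) (sum-pick x (λ _ → 1))

∣∣≤n : (P : Fin n → Bool) → ∣ P ∣ ≤ n
∣∣≤n {n} P = ≤-trans (sum-mono-≤ λ v → ⟦ P v ⟧≤1) (≤-reflexive (trans (sum-const n 1) (*-identityʳ n)))

∣∣-full : ∀ n → ∣ (λ (_ : Fin n) → true) ∣ ≡ n
∣∣-full n = trans (sum-const n 1) (*-identityʳ n)

∣∣-unique : (P : Fin n → Bool) {i : Fin n} → P i ≡ true → (∀ j → P j ≡ true → j ≡ i) → ∣ P ∣ ≡ 1
∣∣-unique {n} P {i} Pi uniq = trans (sum-cong-≗ {n} same) (∣∣-singleton i)
  where
  same : ∀ j → ⟦ P j ⟧ ≡ ⟦ j == i ⟧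
  same j with P j in eq | j Fin.≟ i
  ... | true | yes _ = refl
  ... | true | no j≢i = contradiction (uniq j eq) j≢i
  ... | false | yes refl = contradiction eq (true≢false Pi)
  ... | false | no _ = refl

∣∣<⇒missing : (P : Fin n → Bool) → ∣ P ∣ < n → ∃[ v ] P v ≡ false
∣∣<⇒missing {n} P lt with Fin.any? (λ v → P v Bool.≟ false)
... | yes r = r
... | no none = contradiction (≤-trans lt (≤-reflexive (sym all))) (<-irrefl refl)
  where
  inP : ∀ v → ⟦ P v ⟧ ≡ 1
  inP v with P v in eq
  ... | true = refl
  ... | false = contradiction (v , eq) none
  all : ∣ P ∣ ≡ n
  all = trans (sum-cong-≗ {n} inP) (∣∣-full n)

_∖_ : (Fin n → Bool) → Fin n → Fin n → Bool
(P ∖ x) v = P v ∧ not (v == x)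

_∪ˢ_ : (Fin n → Bool) → Fin n → Fin n → Bool
(P ∪ˢ x) v = P v ∨ (v == x)

split-∖ : (P : Fin n → Bool) {x : Fin n} → P x ≡ true → ∀ v → ⟦ P v ⟧ ≡ ⟦ (P ∖ x) v ⟧ + ⟦ v == x ⟧
split-∖ P {x} Px v with v Fin.≟ x
... | yes refl rewrite Px = refl
... | no _ with P v
... | true = refl
... | false = refl

split-∪ˢ : (P : Fin n → Bool) {x : Fin n} → P x ≡ false → ∀ v → ⟦ (P ∪ˢ x) v ⟧ ≡ ⟦ P v ⟧ + ⟦ v == x ⟧
split-∪ˢ P {x} Px v with v Fin.≟ x
... | yes refl rewrite Px = refl
... | no _ with P v
... | true = refl
... | false = refl

∣∣-split : (P Q : Fin n → Bool) {x : Fin n} → (∀ v → ⟦ P v ⟧ ≡ ⟦ Q v ⟧ + ⟦ v == x ⟧) → ∣ P ∣ ≡ suc ∣ Q ∣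
∣∣-split {n} P Q {x} sp = trans (sum-cong-≗ {n} sp)
  (trans (∑-distrib-+ (λ v → ⟦ Q v ⟧) (λ v → ⟦ v == x ⟧))
    (trans (cong (∣ Q ∣ +_) (∣∣-singleton x)) (+-comm _ 1)))

-- Ordered pairs are counted, so an edge contributes twice and non-adjacency also counts the
-- diagonal; a relation and its complement then add up to exactly `∣ P ∣ * ∣ P ∣`.
∑∑ : (Fin n → Bool) → (Fin n → Fin n → Bool) → ℕ
∑∑ {n} P R = ∑[ u < n ] (⟦ P u ⟧ * (∑[ v < n ] (⟦ P v ⟧ * ⟦ R u v ⟧)))

row : (Fin n → Bool) → (Fin n → Fin n → Bool) → Fin n → ℕ
row {n} P R u = ∑[ v < n ] (⟦ P v ⟧ * ⟦ R u v ⟧)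

row-split : (P Q : Fin n → Bool) (R : Fin n → Fin n → Bool) {x : Fin n} →
  (∀ v → ⟦ P v ⟧ ≡ ⟦ Q v ⟧ + ⟦ v == x ⟧) → ∀ u → row P R u ≡ row Q R u + ⟦ R u x ⟧
row-split {n} P Q R {x} sp u =
  trans (sum-cong-≗ {n} λ v → trans (cong (_* ⟦ R u v ⟧) (sp v)) (*-distribʳ-+ ⟦ R u v ⟧ ⟦ Q v ⟧ _))
    (trans (∑-distrib-+ (λ v → ⟦ Q v ⟧ * ⟦ R u v ⟧) (λ v → ⟦ v == x ⟧ * ⟦ R u v ⟧))
      (cong (row Q R u +_) (sum-pick x (λ v → ⟦ R u v ⟧))))

-- By symmetry the row and the column of `x` contribute equally. The pointwise hypothesis covers
-- both deletion (trimming) and insertion (growing a tree).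
∑∑-split : (P Q : Fin n → Bool) (R : Fin n → Fin n → Bool) {x : Fin n} → (∀ u v → R u v ≡ R v u) →
  (∀ v → ⟦ P v ⟧ ≡ ⟦ Q v ⟧ + ⟦ v == x ⟧) → ∑∑ P R ≡ ∑∑ Q R + (2 * row Q R x + ⟦ R x x ⟧)
∑∑-split {n} P Q R {x} Rsym sp = begin
  ∑[ u < n ] (⟦ P u ⟧ * row P R u)
    ≡⟨ sum-cong-≗ {n} (λ u → trans (cong₂ _*_ (sp u) (row-split P Q R sp u)) (expand ⟦ Q u ⟧ ⟦ u == x ⟧ _ _)) ⟩
  ∑[ u < n ] (⟦ Q u ⟧ * row Q R u + ⟦ Q u ⟧ * ⟦ R u x ⟧ + ⟦ u == x ⟧ * (row Q R u + ⟦ R u x ⟧))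
    ≡⟨ ∑-distrib-+ (λ u → ⟦ Q u ⟧ * row Q R u + ⟦ Q u ⟧ * ⟦ R u x ⟧) (λ u → ⟦ u == x ⟧ * (row Q R u + ⟦ R u x ⟧)) ⟩
  ∑[ u < n ] (⟦ Q u ⟧ * row Q R u + ⟦ Q u ⟧ * ⟦ R u x ⟧) + ∑[ u < n ] (⟦ u == x ⟧ * (row Q R u + ⟦ R u x ⟧))
    ≡⟨ cong₂ _+_ (∑-distrib-+ (λ u → ⟦ Q u ⟧ * row Q R u) (λ u → ⟦ Q u ⟧ * ⟦ R u x ⟧)) (sum-pick x (λ u → row Q R u + ⟦ R u x ⟧)) ⟩
  ∑∑ Q R + ∑[ u < n ] (⟦ Q u ⟧ * ⟦ R u x ⟧) + (row Q R x + ⟦ R x x ⟧)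
    ≡⟨ cong (λ z → ∑∑ Q R + z + (row Q R x + ⟦ R x x ⟧)) (sum-cong-≗ {n} λ u → cong (λ b → ⟦ Q u ⟧ * ⟦ b ⟧) (Rsym u x)) ⟩
  ∑∑ Q R + row Q R x + (row Q R x + ⟦ R x x ⟧)
    ≡⟨ collect (∑∑ Q R) (row Q R x) ⟦ R x x ⟧ ⟩
  ∑∑ Q R + (2 * row Q R x + ⟦ R x x ⟧) ∎
  where
  open ≡-Reasoning
  expand : ∀ q e r s → (q + e) * (r + s) ≡ q * r + q * s + e * (r + s)
  expand = solve-∀
  collect : ∀ a b c → a + b + (b + c) ≡ a + (2 * b + c)
  collect = solve-∀

-- Non-edges

nonadj : SimpleGraph n → Fin n → Fin n → Bool
nonadj G u v = not (adj G u v)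

nonadj-sym : (G : SimpleGraph n) → ∀ u v → nonadj G u v ≡ nonadj G v u
nonadj-sym G u v = cong not (adj-sym G u v)

deg : SimpleGraph n → (Fin n → Bool) → Fin n → ℕ
deg G W = row W (adj G)

codeg : SimpleGraph n → (Fin n → Bool) → Fin n → ℕ
codeg G W = row W (nonadj G)

row-complement : (P : Fin n → Bool) (R : Fin n → Fin n → Bool) (u : Fin n) →
  row P R u + row P (λ x y → not (R x y)) u ≡ ∣ P ∣
row-complement {n} P R u =
  trans (sym (∑-distrib-+ (λ v → ⟦ P v ⟧ * ⟦ R u v ⟧) (λ v → ⟦ P v ⟧ * ⟦ not (R u v) ⟧)))
    (sum-cong-≗ {n} λ v → both (P v) (R u v))
  where
  both : ∀ p r → ⟦ p ⟧ * ⟦ r ⟧ + ⟦ p ⟧ * ⟦ not r ⟧ ≡ ⟦ p ⟧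
  both true true = refl
  both true false = refl
  both false r = refl

∑∑-complement : (P : Fin n → Bool) (R : Fin n → Fin n → Bool) →
  ∑∑ P R + ∑∑ P (λ x y → not (R x y)) ≡ ∣ P ∣ * ∣ P ∣
∑∑-complement {n} P R =
  trans (sym (∑-distrib-+ (λ u → ⟦ P u ⟧ * row P R u) (λ u → ⟦ P u ⟧ * row P (λ x y → not (R x y)) u)))
    (trans (sum-cong-≗ {n} λ u → trans (sym (*-distribˡ-+ ⟦ P u ⟧ (row P R u) _)) (cong (⟦ P u ⟧ *_) (row-complement P R u)))
      (sym (*-distribʳ-sum {n} ∣ P ∣ (λ u → ⟦ P u ⟧))))

nonedges : SimpleGraph n → (Fin n → Bool) → ℕ
nonedges G W = ∑∑ W (nonadj G)

Low : ℕ → SimpleGraph n → (Fin n → Bool) → Fin n → Set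
Low L G W x = deg G W x < L

Full : Fin n → Bool
Full _ = true

deg-mono : (G : SimpleGraph n) (W : Fin n → Bool) (x : Fin n) → deg G W x ≤ deg G Full x
deg-mono G W x = sum-mono-≤ λ v → *-monoˡ-≤ ⟦ adj G x v ⟧ ⟦ W v ⟧≤1

-- A vertex of low degree in B forces about |W| non-edges; the pairs inside B are counted twice.
nonedges-lower : (G : SimpleGraph n) (L : ℕ) (W B : Fin n → Bool) → (∀ x → B x ≡ true → W x ≡ true) →
  (∀ x → B x ≡ true → Low L G W x) →
  2 * (∣ W ∣ * ∣ B ∣) ≤ nonedges G W + ∣ B ∣ * ∣ B ∣ + 2 * (L * ∣ B ∣)
nonedges-lower {n} G L W B B⊆W low = begin
  2 * (w * b)                          ≤⟨ *-monoʳ-≤ 2 rows ⟩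
  2 * (X + L * b)                      ≡⟨ double X (L * b) ⟩
  (X + X) + 2 * (L * b)                ≤⟨ +-monoˡ-≤ (2 * (L * b)) X+X≤ ⟩
  nonedges G W + b * b + 2 * (L * b)   ∎
  where
  open ≤-Reasoning
  w b X Y : ℕ
  w = ∣ W ∣
  b = ∣ B ∣
  X = ∑[ u < n ] (⟦ B u ⟧ * codeg G W u)
  Y = ∑[ u < n ] (⟦ W u ⟧ * codeg G B u)

  double : ∀ p q → 2 * (p + q) ≡ (p + p) + 2 * q
  double = solve-∀

  row≤ : ∀ u → w * ⟦ B u ⟧ ≤ ⟦ B u ⟧ * codeg G W u + L * ⟦ B u ⟧
  row≤ u with B u in eq
  ... | false rewrite *-zeroʳ w = z≤n
  ... | true = subst₂ _≤_ (trans (row-complement W (adj G) u) (sym (*-identityʳ w)))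
                 (trans (+-comm L (codeg G W u)) (cong₂ _+_ (sym (*-identityˡ _)) (sym (*-identityʳ L))))
                 (+-monoˡ-≤ (codeg G W u) (<⇒≤ (low u eq)))

  rows : w * b ≤ X + L * b
  rows = begin
    w * b                                                      ≡⟨ *-distribˡ-sum {n} w (λ u → ⟦ B u ⟧) ⟩
    ∑[ u < n ] (w * ⟦ B u ⟧)                                   ≤⟨ sum-mono-≤ row≤ ⟩
    ∑[ u < n ] (⟦ B u ⟧ * codeg G W u + L * ⟦ B u ⟧)           ≡⟨ ∑-distrib-+ (λ u → ⟦ B u ⟧ * codeg G W u) (λ u → L * ⟦ B u ⟧) ⟩
    X + ∑[ u < n ] (L * ⟦ B u ⟧)                               ≡⟨ cong (X +_) (sym (*-distribˡ-sum {n} L (λ u → ⟦ B u ⟧))) ⟩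
    X + L * b ∎

  swap* : ∀ p q r → p * (q * r) ≡ q * (p * r)
  swap* = solve-∀

  -- Both count the non-adjacent pairs between `B` and `W`, once from each side.
  X≡Y : X ≡ Y
  X≡Y = trans (sum-cong-≗ {n} λ u → *-distribˡ-sum {n} ⟦ B u ⟧ (λ v → ⟦ W v ⟧ * ⟦ nonadj G u v ⟧))
    (trans (∑-comm {n} {n} λ u v → ⟦ B u ⟧ * (⟦ W v ⟧ * ⟦ nonadj G u v ⟧))
      (sum-cong-≗ {n} λ v → trans
        (sum-cong-≗ {n} λ u → trans (swap* ⟦ B u ⟧ ⟦ W v ⟧ _) (cong (λ z → ⟦ W v ⟧ * (⟦ B u ⟧ * ⟦ z ⟧)) (nonadj-sym G u v)))
        (sym (*-distribˡ-sum {n} ⟦ W v ⟧ (λ u → ⟦ B u ⟧ * ⟦ nonadj G v u ⟧)))))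

  -- A pair counted from both sides has both ends in `B`; the extra term on the right pays for
  -- exactly these.
  point : ∀ bu wu bv wv a → (bu ≡ true → wu ≡ true) → (bv ≡ true → wv ≡ true) →
    ⟦ bu ⟧ * (⟦ wv ⟧ * ⟦ a ⟧) + ⟦ wu ⟧ * (⟦ bv ⟧ * ⟦ a ⟧) ≤ ⟦ wu ⟧ * (⟦ wv ⟧ * ⟦ a ⟧) + ⟦ bu ⟧ * ⟦ bv ⟧
  point true wu true wv true p q rewrite p refl | q refl = s≤s (s≤s z≤n)
  point true wu false wv true p q rewrite p refl | +-identityʳ (⟦ wv ⟧ * 1) = ≤-refl
  point false wu true wv true p q rewrite q refl | +-identityʳ (⟦ wu ⟧ * 1) = ≤-refl
  point false wu false wv true p q rewrite *-zeroʳ ⟦ wu ⟧ = z≤n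
  point bu wu bv wv false p q rewrite *-zeroʳ ⟦ wv ⟧ | *-zeroʳ ⟦ bv ⟧ | *-zeroʳ ⟦ wu ⟧ | *-zeroʳ ⟦ bu ⟧ = z≤n

  X+Y≤ : X + Y ≤ nonedges G W + b * b
  X+Y≤ = begin
    X + Y
      ≡⟨ sym (∑-distrib-+ (λ u → ⟦ B u ⟧ * codeg G W u) (λ u → ⟦ W u ⟧ * codeg G B u)) ⟩
    ∑[ u < n ] (⟦ B u ⟧ * codeg G W u + ⟦ W u ⟧ * codeg G B u)
      ≤⟨ sum-mono-≤ perRow ⟩
    ∑[ u < n ] (⟦ W u ⟧ * codeg G W u + ⟦ B u ⟧ * b)
      ≡⟨ ∑-distrib-+ (λ u → ⟦ W u ⟧ * codeg G W u) (λ u → ⟦ B u ⟧ * b) ⟩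
    nonedges G W + ∑[ u < n ] (⟦ B u ⟧ * b)
      ≡⟨ cong (nonedges G W +_) (sym (*-distribʳ-sum {n} b (λ u → ⟦ B u ⟧))) ⟩
    nonedges G W + b * b ∎
    where
    perRow : ∀ u → ⟦ B u ⟧ * codeg G W u + ⟦ W u ⟧ * codeg G B u ≤ ⟦ W u ⟧ * codeg G W u + ⟦ B u ⟧ * b
    perRow u = begin
      ⟦ B u ⟧ * codeg G W u + ⟦ W u ⟧ * codeg G B u
        ≡⟨ cong₂ _+_ (*-distribˡ-sum {n} ⟦ B u ⟧ (λ v → ⟦ W v ⟧ * ⟦ nonadj G u v ⟧)) (*-distribˡ-sum {n} ⟦ W u ⟧ (λ v → ⟦ B v ⟧ * ⟦ nonadj G u v ⟧)) ⟩
      ∑[ v < n ] (⟦ B u ⟧ * (⟦ W v ⟧ * ⟦ nonadj G u v ⟧)) + ∑[ v < n ] (⟦ W u ⟧ * (⟦ B v ⟧ * ⟦ nonadj G u v ⟧))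
        ≡⟨ sym (∑-distrib-+ (λ v → ⟦ B u ⟧ * (⟦ W v ⟧ * ⟦ nonadj G u v ⟧)) (λ v → ⟦ W u ⟧ * (⟦ B v ⟧ * ⟦ nonadj G u v ⟧))) ⟩
      ∑[ v < n ] (⟦ B u ⟧ * (⟦ W v ⟧ * ⟦ nonadj G u v ⟧) + ⟦ W u ⟧ * (⟦ B v ⟧ * ⟦ nonadj G u v ⟧))
        ≤⟨ sum-mono-≤ (λ v → point (B u) (W u) (B v) (W v) (nonadj G u v) (B⊆W u) (B⊆W v)) ⟩
      ∑[ v < n ] (⟦ W u ⟧ * (⟦ W v ⟧ * ⟦ nonadj G u v ⟧) + ⟦ B u ⟧ * ⟦ B v ⟧)
        ≡⟨ ∑-distrib-+ (λ v → ⟦ W u ⟧ * (⟦ W v ⟧ * ⟦ nonadj G u v ⟧)) (λ v → ⟦ B u ⟧ * ⟦ B v ⟧) ⟩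
      ∑[ v < n ] (⟦ W u ⟧ * (⟦ W v ⟧ * ⟦ nonadj G u v ⟧)) + ∑[ v < n ] (⟦ B u ⟧ * ⟦ B v ⟧)
        ≡⟨ sym (cong₂ _+_ (*-distribˡ-sum {n} ⟦ W u ⟧ (λ v → ⟦ W v ⟧ * ⟦ nonadj G u v ⟧)) (*-distribˡ-sum {n} ⟦ B u ⟧ (λ v → ⟦ B v ⟧))) ⟩
      ⟦ W u ⟧ * codeg G W u + ⟦ B u ⟧ * b ∎

  X+X≤ : X + X ≤ nonedges G W + b * b
  X+X≤ = subst (λ z → X + z ≤ nonedges G W + b * b) (sym X≡Y) X+Y≤

-- Trimming

total-nonedges : GraphSystem k n → (Fin n → Bool) → ℕ
total-nonedges 𝒢 W = sum (λ i → nonedges (𝒢 i) W)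

TwoLow : ℕ → GraphSystem k n → (Fin n → Bool) → Fin n → Set
TwoLow L 𝒢 W x = ∃[ i ] ∃[ j ] (i ≢ j × Low L (𝒢 i) W x × Low L (𝒢 j) W x)

twoLow? : (L : ℕ) (𝒢 : GraphSystem k n) (W : Fin n → Bool) (x : Fin n) → Dec (TwoLow L 𝒢 W x)
twoLow? L 𝒢 W x = Fin.any? λ i → Fin.any? λ j →
  ¬? (i Fin.≟ j) ×-dec (deg (𝒢 i) W x <? L ×-dec deg (𝒢 j) W x <? L)

Trimmed : ℕ → GraphSystem k n → (Fin n → Bool) → Set
Trimmed L 𝒢 W = ∀ x → W x ≡ true → ¬ TwoLow L 𝒢 W x

-- With K colours of density ((K-1)/K)² each, the non-edges number about (2K-1)n²/K in total;
-- deleting a vertex with two low colours removes at least as many of them as it lowers 2|W|²,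
-- up to an error that the middle term absorbs.
Dense : ℕ → GraphSystem k n → (Fin n → Bool) → Set
Dense {k} {n} L 𝒢 W = k * total-nonedges 𝒢 W + 4 * (k * (L * ∣ W ∣)) + n * n ≤ 2 * (k * (∣ W ∣ * ∣ W ∣))

dense-∖ : (L : ℕ) (𝒢 : GraphSystem k n) (W : Fin n → Bool) {x : Fin n} → W x ≡ true →
  TwoLow L 𝒢 W x → Dense L 𝒢 W → Dense L 𝒢 (W ∖ x)
dense-∖ {k} {n} L 𝒢 W {x} Wx (i , j , i≢j , lowi , lowj) dense =
  -- The cancelled amount is the drop of `2 * (k * (∣ W ∣ * ∣ W ∣))` when one vertex goes. The error
  -- term drops by `4 * (k * L)`, which pays for the neighbours that `x` still has in its two low
  -- colours.
  +-cancelʳ-≤ (k * (4 * w′ + 2)) _ _ (begin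
    k * N′ + 4 * (k * (L * w′)) + n * n + k * (4 * w′ + 2)
      ≤⟨ +-monoʳ-≤ _ (*-monoʳ-≤ k removed) ⟩
    k * N′ + 4 * (k * (L * w′)) + n * n + k * (S + 4 * L)
      ≡⟨ lhs k N′ L w′ (n * n) S ⟩
    k * (N′ + S) + 4 * (k * (L * suc w′)) + n * n
      ≡⟨ cong₂ (λ p q → k * p + 4 * (k * (L * q)) + n * n) (sym N-split) (sym w-split) ⟩
    k * total-nonedges 𝒢 W + 4 * (k * (L * ∣ W ∣)) + n * n
      ≤⟨ dense ⟩
    2 * (k * (∣ W ∣ * ∣ W ∣))
      ≡⟨ cong (λ q → 2 * (k * (q * q))) w-split ⟩
    2 * (k * (suc w′ * suc w′))
      ≡⟨ rhs k w′ ⟩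
    2 * (k * (w′ * w′)) + k * (4 * w′ + 2) ∎)
  where
  open ≤-Reasoning
  W′ = W ∖ x
  w′ N′ S : ℕ
  w′ = ∣ W′ ∣
  N′ = total-nonedges 𝒢 W′
  drop : Fin k → ℕ
  drop c = 2 * codeg (𝒢 c) W′ x + ⟦ nonadj (𝒢 c) x x ⟧
  S = sum drop

  w-split : ∣ W ∣ ≡ suc w′
  w-split = ∣∣-split W W′ (split-∖ W Wx)

  N-split : total-nonedges 𝒢 W ≡ N′ + S
  N-split = trans (sum-cong-≗ {k} λ c → ∑∑-split W W′ (nonadj (𝒢 c)) (nonadj-sym (𝒢 c)) (split-∖ W Wx))
    (∑-distrib-+ (λ c → nonedges (𝒢 c) W′) drop)

  diag : ∀ c → ⟦ nonadj (𝒢 c) x x ⟧ ≡ 1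
  diag c = cong (λ b → ⟦ not b ⟧) (adj-irrefl (𝒢 c) x)

  drop-low : ∀ {c} → Low L (𝒢 c) W x → 2 * w′ + 1 ≤ drop c + 2 * L
  drop-low {c} low = begin
    2 * w′ + 1                    ≤⟨ +-monoˡ-≤ 1 (*-monoʳ-≤ 2 (≤-pred both)) ⟩
    2 * (L + codeg (𝒢 c) W′ x) + 1   ≡⟨ regroup L (codeg (𝒢 c) W′ x) 1 ⟩
    2 * codeg (𝒢 c) W′ x + 1 + 2 * L ≡⟨ cong (λ z → 2 * codeg (𝒢 c) W′ x + z + 2 * L) (sym (diag c)) ⟩
    drop c + 2 * L ∎
    where
    regroup : ∀ a b d → 2 * (a + b) + d ≡ 2 * b + d + 2 * a
    regroup = solve-∀
    both : suc w′ ≤ suc (L + codeg (𝒢 c) W′ x)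
    both = begin
      suc w′                                    ≡⟨ sym w-split ⟩
      ∣ W ∣                                     ≡⟨ sym (row-complement W (adj (𝒢 c)) x) ⟩
      deg (𝒢 c) W x + codeg (𝒢 c) W x           ≤⟨ +-monoˡ-≤ _ (<⇒≤ low) ⟩
      L + codeg (𝒢 c) W x                       ≡⟨ cong (L +_) (row-split W W′ (nonadj (𝒢 c)) (split-∖ W Wx) x) ⟩
      L + (codeg (𝒢 c) W′ x + ⟦ nonadj (𝒢 c) x x ⟧) ≡⟨ cong (λ z → L + (codeg (𝒢 c) W′ x + z)) (diag c) ⟩
      L + (codeg (𝒢 c) W′ x + 1)                ≡⟨ shift L (codeg (𝒢 c) W′ x) ⟩
      suc (L + codeg (𝒢 c) W′ x) ∎
      where
      shift : ∀ a b → a + (b + 1) ≡ suc (a + b)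
      shift = solve-∀

  removed : 4 * w′ + 2 ≤ S + 4 * L
  removed = begin
    4 * w′ + 2                              ≡⟨ halves w′ ⟩
    (2 * w′ + 1) + (2 * w′ + 1)             ≤⟨ +-mono-≤ (drop-low lowi) (drop-low lowj) ⟩
    (drop i + 2 * L) + (drop j + 2 * L)     ≡⟨ gather (drop i) (drop j) L ⟩
    (drop i + drop j) + 4 * L               ≤⟨ +-monoˡ-≤ (4 * L) (two-terms≤sum drop i≢j) ⟩
    S + 4 * L ∎
    where
    halves : ∀ a → 4 * a + 2 ≡ (2 * a + 1) + (2 * a + 1)
    halves = solve-∀
    gather : ∀ a b c → (a + 2 * c) + (b + 2 * c) ≡ (a + b) + 4 * c
    gather = solve-∀

  lhs : ∀ a b l w q s → a * b + 4 * (a * (l * w)) + q + a * (s + 4 * l) ≡ a * (b + s) + 4 * (a * (l * suc w)) + q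
  lhs = solve-∀
  rhs : ∀ a w → 2 * (a * (suc w * suc w)) ≡ 2 * (a * (w * w)) + a * (4 * w + 2)
  rhs = solve-∀

trim : (L : ℕ) (𝒢 : GraphSystem k n) (s : ℕ) (W : Fin n → Bool) → ∣ W ∣ ≡ s → Dense L 𝒢 W →
  ∃[ W′ ] (Dense L 𝒢 W′ × Trimmed L 𝒢 W′)
trim L 𝒢 s W size dense with Fin.any? (λ x → (W x Bool.≟ true) ×-dec twoLow? L 𝒢 W x)
... | no none = W , dense , λ x Wx two → none (x , Wx , two)
trim L 𝒢 zero W size dense | yes (x , Wx , two) with () ← trans (sym size) (∣∣-split W (W ∖ x) (split-∖ W Wx))
trim L 𝒢 (suc s) W size dense | yes (x , Wx , two) =
  trim L 𝒢 s (W ∖ x) (suc-injective (trans (sym (∣∣-split W (W ∖ x) (split-∖ W Wx))) size)) (dense-∖ L 𝒢 W Wx two dense)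

-- k²(2|E|) ≥ (k-1)²n² + 4k²Ln, expressed through the non-adjacent ordered pairs.
EdgeDense : ℕ → ℕ → SimpleGraph n → Set
EdgeDense {n} k L G = k * k * nonedges G Full + 4 * (k * k * (L * n)) + n * n ≤ 2 * (k * (n * n))

-- If low vertices form a proportion β, they force about 1 - (1 - β)² of all ordered pairs to be
-- non-adjacent, while `EdgeDense` leaves at most 1 - (1 - 1/k)². Hence β ≤ 1/k.
few-low : (k L : ℕ) (G : SimpleGraph n) → EdgeDense k L G → (B : Fin n → Bool) →
  (∀ x → B x ≡ true → Low L G Full x) → k * ∣ B ∣ ≤ n
few-low {n} k L G dense B low with k * ∣ B ∣ ≤? n
... | yes le = le
... | no nle = contradiction tooBig λ ()
  where
  open ≤-Reasoning
  b kb c e : ℕ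
  b = ∣ B ∣
  kb = k * b
  -- Two gaps replace subtraction: `suc c` leads from `n` up to `kb`, and `e` from `kb` up to
  -- `k * n`.
  c = kb ∸ suc n
  e = k * n ∸ kb
  kb≡ : kb ≡ n + suc c
  kb≡ = trans (sym (m+[n∸m]≡n (≰⇒> nle))) (sym (+-suc n c))
  kn≡ : k * n ≡ (n + suc c) + e
  kn≡ = trans (sym (m+[n∸m]≡n (*-monoʳ-≤ k (∣∣≤n B)))) (cong (_+ e) kb≡)

  assoc₁ : ∀ a x y → a * a * (2 * (x * y)) ≡ 2 * ((a * x) * (a * y))
  assoc₁ = solve-∀
  assoc₂ : ∀ a N y l x → a * a * (N + y * y + 2 * (l * y)) + 2 * (a * a * (l * x)) ≡ (a * a * N + 2 * (a * a * (l * x)) + 2 * (a * a * (l * y))) + (a * y) * (a * y)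
  assoc₂ = solve-∀
  assoc₃ : ∀ a x → 2 * (a * (x * x)) ≡ 2 * ((a * x) * x)
  assoc₃ = solve-∀
  merge : ∀ p q → p + 2 * q + 2 * q ≡ p + 4 * q
  merge = solve-∀

  -- Half of the error term in `EdgeDense`. The other half absorbs the low degrees from
  -- `nonedges-lower`.
  P : ℕ
  P = 2 * (k * k * (L * n))

  bound : 2 * ((k * n) * kb) + P + n * n ≤ 2 * ((k * n) * n) + kb * kb
  bound = begin
    2 * ((k * n) * kb) + P + n * n
      ≡⟨ cong (λ z → z + P + n * n) (sym (assoc₁ k n b)) ⟩
    k * k * (2 * (n * b)) + P + n * n
      ≤⟨ +-monoˡ-≤ (n * n) (+-monoˡ-≤ P (*-monoʳ-≤ (k * k)
           (subst (λ z → 2 * (z * b) ≤ nonedges G Full + b * b + 2 * (L * b)) (∣∣-full n)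
             (nonedges-lower G L Full B (λ _ _ → refl) low)))) ⟩
    k * k * (nonedges G Full + b * b + 2 * (L * b)) + P + n * n
      ≡⟨ cong (_+ n * n) (assoc₂ k (nonedges G Full) b L n) ⟩
    (k * k * nonedges G Full + P + 2 * (k * k * (L * b))) + kb * kb + n * n
      ≤⟨ +-monoˡ-≤ (n * n) (+-monoˡ-≤ (kb * kb) (+-monoʳ-≤ (k * k * nonedges G Full + P) (*-monoʳ-≤ 2 (*-monoʳ-≤ (k * k) (*-monoʳ-≤ L (∣∣≤n B)))))) ⟩
    (k * k * nonedges G Full + P + P) + kb * kb + n * n
      ≡⟨ cong (λ z → z + kb * kb + n * n) (merge (k * k * nonedges G Full) (k * k * (L * n))) ⟩
    (k * k * nonedges G Full + 4 * (k * k * (L * n))) + kb * kb + n * n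
      ≡⟨ swap (k * k * nonedges G Full + 4 * (k * k * (L * n))) (kb * kb) (n * n) ⟩
    (k * k * nonedges G Full + 4 * (k * k * (L * n)) + n * n) + kb * kb
      ≤⟨ +-monoˡ-≤ (kb * kb) dense ⟩
    2 * (k * (n * n)) + kb * kb
      ≡⟨ cong (_+ kb * kb) (assoc₃ k n) ⟩
    2 * ((k * n) * n) + kb * kb ∎
    where
    swap : ∀ p q r → p + q + r ≡ p + r + q
    swap = solve-∀

  -- (kb - n)(2kn - n - kb) ≤ -P, with kb = n + suc c and kn = kb + e
  tooBig : suc (c * c + 2 * c + 2 * (suc c * e) + P) ≤ 0
  tooBig = +-cancelʳ-≤ (2 * (n * n) + 2 * (n * suc c) + 2 * (n * e) + (n + suc c) * (n + suc c)) _ _ (begin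
    suc (c * c + 2 * c + 2 * (suc c * e) + P) + (2 * (n * n) + 2 * (n * suc c) + 2 * (n * e) + (n + suc c) * (n + suc c))
      ≡⟨ left n c e P ⟩
    2 * ((n + suc c + e) * (n + suc c)) + P + n * n
      ≡⟨ cong₂ (λ p q → 2 * (p * q) + P + n * n) (sym kn≡) (sym kb≡) ⟩
    2 * ((k * n) * kb) + P + n * n
      ≤⟨ bound ⟩
    2 * ((k * n) * n) + kb * kb
      ≡⟨ cong₂ (λ p q → 2 * (p * n) + q * q) kn≡ kb≡ ⟩
    2 * ((n + suc c + e) * n) + (n + suc c) * (n + suc c)
      ≡⟨ right n c e ⟩
    2 * (n * n) + 2 * (n * suc c) + 2 * (n * e) + (n + suc c) * (n + suc c) ∎)
    where
    left : ∀ n c e P → suc (c * c + 2 * c + 2 * (suc c * e) + P) + (2 * (n * n) + 2 * (n * suc c) + 2 * (n * e) + (n + suc c) * (n + suc c)) ≡ 2 * ((n + suc c + e) * (n + suc c)) + P + n * n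
    left = solve-∀
    right : ∀ n c e → 2 * ((n + suc c + e) * n) + (n + suc c) * (n + suc c) ≡ 2 * (n * n) + 2 * (n * suc c) + 2 * (n * e) + (n + suc c) * (n + suc c)
    right = solve-∀

-- Sum `EdgeDense` over the `K` colours and cancel one factor `K`. The error term of `EdgeDense` has
-- a factor `K` to spare.
dense-start : (L : ℕ) (𝒢 : GraphSystem (suc k) n) → (∀ i → EdgeDense (suc k) L (𝒢 i)) → Dense L 𝒢 Full
dense-start {k} {n} L 𝒢 dense = *-cancelˡ-≤ K (begin
  K * (K * N + 4 * (K * (L * f)) + n * n)
    ≡⟨ cong (λ z → K * (K * N + 4 * (K * (L * z)) + n * n)) (∣∣-full n) ⟩
  K * (K * N + 4 * (K * (L * n)) + n * n)
    ≤⟨ *-monoʳ-≤ K (+-monoˡ-≤ (n * n) (+-monoʳ-≤ (K * N) (*-monoʳ-≤ 4 (*-monoˡ-≤ (L * n) (m≤m*n K K))))) ⟩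
  K * (K * N + 4 * (K * K * (L * n)) + n * n)
    ≡⟨ expand K N (4 * (K * K * (L * n))) (n * n) ⟩
  K * K * N + (K * (4 * (K * K * (L * n)) + n * n))
    ≡⟨ cong₂ _+_ (*-distribˡ-sum {K} (K * K) (λ i → nonedges (𝒢 i) Full)) (sym (sum-const K _)) ⟩
  ∑[ i < K ] (K * K * nonedges (𝒢 i) Full) + ∑[ i < K ] (4 * (K * K * (L * n)) + n * n)
    ≡⟨ sym (∑-distrib-+ (λ i → K * K * nonedges (𝒢 i) Full) (λ i → 4 * (K * K * (L * n)) + n * n)) ⟩
  ∑[ i < K ] (K * K * nonedges (𝒢 i) Full + (4 * (K * K * (L * n)) + n * n))
    ≤⟨ sum-mono-≤ (λ i → ≤-trans (≤-reflexive (sym (+-assoc (K * K * nonedges (𝒢 i) Full) (4 * (K * K * (L * n))) (n * n)))) (dense i)) ⟩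
  ∑[ i < K ] (2 * (K * (n * n)))
    ≡⟨ sum-const K _ ⟩
  K * (2 * (K * (n * n)))
    ≡⟨ cong (λ z → K * (2 * (K * (z * z)))) (sym (∣∣-full n)) ⟩
  K * (2 * (K * (f * f))) ∎)
  where
  open ≤-Reasoning
  K N f : ℕ
  K = suc k
  N = total-nonedges 𝒢 Full
  f = ∣ Full {n} ∣
  expand : ∀ a b c d → a * (a * b + c + d) ≡ a * a * b + (a * (c + d))
  expand = solve-∀

-- Degrees are taken in the whole graph: the leaf is placed last, and nothing has to be continued
-- from it.
Rich : ℕ → GraphSystem k n → Fin n → Set
Rich L 𝒢 y = ∀ i → L ≤ deg (𝒢 i) Full y

-- If no vertex of the trimmed set W were rich, the low sets of the k colours would partition W
-- into parts of size at most n/k, too small to account for the few non-edges inside W.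
rich-vertex : (L : ℕ) (𝒢 : GraphSystem (suc k) n) → (∀ i → EdgeDense (suc k) (suc L) (𝒢 i)) → 0 < n →
  (W : Fin n → Bool) → Dense (suc L) 𝒢 W → Trimmed (suc L) 𝒢 W →
  ∃[ y ] (W y ≡ true × Rich (suc L) 𝒢 y)
rich-vertex {k} {n} L₀ 𝒢 edgeDense n>0 W dense trimmed
  with Fin.any? (λ y → (W y Bool.≟ true) ×-dec Fin.all? (λ i → suc L₀ ≤? deg (𝒢 i) Full y))
... | yes r = r
... | no none = ⊥-elim (impossible (∣ W ∣) refl)
  where
  open ≤-Reasoning
  K L w : ℕ
  K = suc k
  L = suc L₀
  w = ∣ W ∣

  low low′ : Fin K → Fin n → Bool
  low i x = does (deg (𝒢 i) Full x <? L)
  low′ i x = W x ∧ low i x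

  low⇒ : ∀ i x → low i x ≡ true → Low L (𝒢 i) Full x
  low⇒ i x = does⇒ (deg (𝒢 i) Full x <? L)

  low′⇒W : ∀ i x → low′ i x ≡ true → W x ≡ true
  low′⇒W i x e with W x
  ... | true = refl
  ... | false with () ← e

  low′⇒Low : ∀ i x → low′ i x ≡ true → Low L (𝒢 i) Full x
  low′⇒Low i x e with W x
  ... | true = low⇒ i x e
  ... | false with () ← e

  restrict : ∀ i x → Low L (𝒢 i) Full x → Low L (𝒢 i) W x
  restrict i x = ≤-<-trans (deg-mono (𝒢 i) W x)

  someLow : ∀ x → W x ≡ true → ∃[ i ] Low L (𝒢 i) Full x
  someLow x Wx with Fin.any? (λ i → deg (𝒢 i) Full x <? L)
  ... | yes r = r
  ... | no no-low = contradiction (x , Wx , λ i → ≮⇒≥ λ lt → no-low (i , lt)) none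

  -- At least one colour is low because `x` is not rich. At most one is, because low in the whole
  -- graph implies low in `W`, and `W` is trimmed.
  oneLow : ∀ x → ∑[ i < K ] ⟦ low′ i x ⟧ ≡ ⟦ W x ⟧
  oneLow x with W x in eq
  ... | false = sum-zero {K} λ _ → refl
  ... | true with someLow x eq
  ...   | i , lowi = ∣∣-unique (λ c → low c x) (dec-true (_ <? _) lowi) only
    where
    only : ∀ j → low j x ≡ true → j ≡ i
    only j e with j Fin.≟ i
    ... | yes p = p
    ... | no j≢i = contradiction (j , i , j≢i , restrict j x (low⇒ j x e) , restrict i x lowi) (trimmed x eq)

  a : Fin K → ℕ
  a i = ∣ low′ i ∣

  ∑a≡w : sum a ≡ w
  ∑a≡w = trans (∑-comm {K} {n} (λ i x → ⟦ low′ i x ⟧)) (sum-cong-≗ {n} oneLow)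

  a-small : ∀ i → K * a i ≤ n
  a-small i = few-low K L (𝒢 i) (edgeDense i) (low′ i) (low′⇒Low i)

  squares : K * ∑[ i < K ] (a i * a i) ≤ w * n
  squares = begin
    K * ∑[ i < K ] (a i * a i)     ≡⟨ *-distribˡ-sum {K} K (λ i → a i * a i) ⟩
    ∑[ i < K ] (K * (a i * a i))   ≤⟨ sum-mono-≤ (λ i → ≤-trans (≤-reflexive (pull K (a i))) (*-monoʳ-≤ (a i) (a-small i))) ⟩
    ∑[ i < K ] (a i * n)           ≡⟨ sym (*-distribʳ-sum {K} n a) ⟩
    sum a * n                      ≡⟨ cong (_* n) ∑a≡w ⟩
    w * n ∎
    where
    pull : ∀ x y → x * (y * y) ≡ y * (x * y)
    pull = solve-∀

  N : ℕ
  N = total-nonedges 𝒢 W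

  counted : 2 * (w * w) ≤ N + ∑[ i < K ] (a i * a i) + 2 * (L * w)
  counted = begin
    2 * (w * w)
      ≡⟨ cong (λ z → 2 * (w * z)) (sym ∑a≡w) ⟩
    2 * (w * sum a)
      ≡⟨ cong (2 *_) (*-distribˡ-sum {K} w a) ⟩
    2 * ∑[ i < K ] (w * a i)
      ≡⟨ *-distribˡ-sum {K} 2 (λ i → w * a i) ⟩
    ∑[ i < K ] (2 * (w * a i))
      ≤⟨ sum-mono-≤ (λ i → nonedges-lower (𝒢 i) L W (low′ i) (low′⇒W i) (λ x e → restrict i x (low′⇒Low i x e))) ⟩
    ∑[ i < K ] (nonedges (𝒢 i) W + a i * a i + 2 * (L * a i))
      ≡⟨ ∑-distrib-+ (λ i → nonedges (𝒢 i) W + a i * a i) (λ i → 2 * (L * a i)) ⟩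
    ∑[ i < K ] (nonedges (𝒢 i) W + a i * a i) + ∑[ i < K ] (2 * (L * a i))
      ≡⟨ cong₂ _+_ (∑-distrib-+ (λ i → nonedges (𝒢 i) W) (λ i → a i * a i))
           (trans (sym (*-distribˡ-sum {K} 2 (λ i → L * a i))) (cong (2 *_) (trans (sym (*-distribˡ-sum {K} L a)) (cong (L *_) ∑a≡w)))) ⟩
    N + ∑[ i < K ] (a i * a i) + 2 * (L * w) ∎

  -- `Dense` bounds the non-edges in `W` from above and `counted` from below, so `K * N` cancels and
  -- only the squares and the error terms remain.
  final : 4 * (K * (L * w)) + n * n ≤ w * n + 2 * (K * (L * w))
  final = +-cancelˡ-≤ (K * N) _ _ (begin
    K * N + (4 * (K * (L * w)) + n * n)  ≡⟨ sym (+-assoc (K * N) _ _) ⟩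
    K * N + 4 * (K * (L * w)) + n * n    ≤⟨ dense ⟩
    2 * (K * (w * w))                    ≡⟨ comm2 K (w * w) ⟩
    K * (2 * (w * w))                    ≤⟨ *-monoʳ-≤ K counted ⟩
    K * (N + ∑[ i < K ] (a i * a i) + 2 * (L * w)) ≡⟨ distr K N (∑[ i < K ] (a i * a i)) (L * w) ⟩
    K * N + (K * ∑[ i < K ] (a i * a i) + 2 * (K * (L * w))) ≤⟨ +-monoʳ-≤ (K * N) (+-monoˡ-≤ _ squares) ⟩
    K * N + (w * n + 2 * (K * (L * w))) ∎)
    where
    comm2 : ∀ x y → 2 * (x * y) ≡ x * (2 * y)
    comm2 = solve-∀
    distr : ∀ x p q r → x * (p + q + 2 * r) ≡ x * p + (x * q + 2 * (x * r))
    distr = solve-∀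

  excess : 2 * (K * (L * w)) ≤ 0
  excess = +-cancelʳ-≤ (n * n + 2 * (K * (L * w))) _ _ (begin
    2 * (K * (L * w)) + (n * n + 2 * (K * (L * w))) ≡⟨ four (K * (L * w)) (n * n) ⟩
    4 * (K * (L * w)) + n * n                       ≤⟨ final ⟩
    w * n + 2 * (K * (L * w))                       ≤⟨ +-monoˡ-≤ _ (*-monoˡ-≤ n (∣∣≤n W)) ⟩
    n * n + 2 * (K * (L * w)) ∎)
    where
    four : ∀ x y → 2 * x + (y + 2 * x) ≡ 4 * x + y
    four = solve-∀

  -- `excess` fails for nonempty `W` because `L` is a successor. If trimming has deleted everything,
  -- `final` reads `n * n ≤ 0`.
  impossible : ∀ s → w ≡ s → ⊥
  impossible (suc s) eq with () ← subst (λ z → 2 * (K * (L * z)) ≤ 0) eq excess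
  impossible zero eq = n≮0 (≤-trans (*-mono-≤ n>0 n>0) (subst₂ _≤_ (vanish K L n) (vanish′ K L n)
    (subst (λ z → 4 * (K * (L * z)) + n * n ≤ z * n + 2 * (K * (L * z))) eq final)))
    where
    vanish : ∀ x y z → 4 * (x * (y * 0)) + z * z ≡ z * z
    vanish = solve-∀
    vanish′ : ∀ x y z → 0 * z + 2 * (x * (y * 0)) ≡ 0
    vanish′ = solve-∀

-- Edge counts

length-filter : {A : Set} {P : A → Set} (P? : Decidable P) (b : A → Bool) → (∀ x → does (P? x) ≡ b x) →
  ∀ xs → List.length (List.filter P? xs) ≡ ListAction.sum (List.map (λ x → ⟦ b x ⟧) xs)
length-filter P? b same List.[] = refl
length-filter P? b same (x List.∷ xs) with does (P? x) | same x
... | true | e rewrite sym e = cong suc (length-filter P? b same xs)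
... | false | e rewrite sym e = length-filter P? b same xs

sum-concatMap : {A B : Set} (g : B → ℕ) (h : A → List.List B) → ∀ xs →
  ListAction.sum (List.map g (List.concatMap h xs)) ≡ ListAction.sum (List.map (λ x → ListAction.sum (List.map g (h x))) xs)
sum-concatMap g h List.[] = refl
sum-concatMap g h (x List.∷ xs) =
  trans (cong ListAction.sum (List.map-++ g (h x) (List.concatMap h xs)))
    (trans (ListAction.sum-++ (List.map g (h x)) _) (cong (ListAction.sum (List.map g (h x)) +_) (sum-concatMap g h xs)))

sum-tabulate : {A : Set} (g : A → ℕ) (f : Fin n → A) → ListAction.sum (List.map g (List.tabulate f)) ≡ sum (g ∘ f)
sum-tabulate {zero} g f = refl
sum-tabulate {suc n} g f = cong (g (f Fin.zero) +_) (sum-tabulate g (f ∘ Fin.suc))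

_<ᶠ_ : Fin n → Fin n → Bool
u <ᶠ v = ⌊ toℕ u <? toℕ v ⌋

edgeCount-sum : (G : SimpleGraph n) → edgeCount G ≡ ∑[ u < n ] ∑[ v < n ] ⟦ (u <ᶠ v) ∧ adj G u v ⟧
edgeCount-sum {n} G =
  trans (length-filter _ b (λ { (u , v) → ≟true (b (u , v)) }) (List.concatMap pairs (List.allFin n)))
    (trans (sum-concatMap (λ x → ⟦ b x ⟧) pairs (List.allFin n))
      (trans (sum-tabulate {n} (λ u → ListAction.sum (List.map (λ x → ⟦ b x ⟧) (pairs u))) id)
        (sum-cong-≗ {n} λ u → trans (cong ListAction.sum (sym (List.map-∘ (List.allFin n))))
          (sum-tabulate {n} (λ v → ⟦ b (u , v) ⟧) id))))
  where
  pairs : Fin n → List.List (Fin n × Fin n)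
  pairs u = List.map (λ v → u , v) (List.allFin n)
  b : Fin n × Fin n → Bool
  b (u , v) = (u <ᶠ v) ∧ adj G u v
  ≟true : ∀ c → does (c Bool.≟ true) ≡ c
  ≟true true = refl
  ≟true false = refl

handshake : (G : SimpleGraph n) → ∑∑ Full (adj G) ≡ 2 * edgeCount G
handshake {n} G = begin
  ∑∑ Full (adj G)
    ≡⟨ sum-cong-≗ {n} (λ u → trans (+-identityʳ (row Full (adj G) u)) (sum-cong-≗ {n} (orient u))) ⟩
  ∑[ u < n ] ∑[ v < n ] (e u v + e v u)
    ≡⟨ sum-cong-≗ {n} (λ u → ∑-distrib-+ {n} (e u) (λ v → e v u)) ⟩
  ∑[ u < n ] (∑[ v < n ] e u v + ∑[ v < n ] e v u)
    ≡⟨ ∑-distrib-+ {n} (λ u → ∑[ v < n ] e u v) (λ u → ∑[ v < n ] e v u) ⟩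
  ∑[ u < n ] ∑[ v < n ] e u v + ∑[ u < n ] ∑[ v < n ] e v u
    ≡⟨ cong₂ _+_ (sym (edgeCount-sum G)) (trans (∑-comm {n} {n} (λ u v → e v u)) (sym (edgeCount-sum G))) ⟩
  edgeCount G + edgeCount G
    ≡⟨ cong (edgeCount G +_) (sym (+-identityʳ (edgeCount G))) ⟩
  2 * edgeCount G ∎
  where
  open ≡-Reasoning
  e : Fin n → Fin n → ℕ
  e u v = ⟦ (u <ᶠ v) ∧ adj G u v ⟧
  orient : ∀ u v → 1 * ⟦ adj G u v ⟧ ≡ e u v + e v u
  orient u v with toℕ u <? toℕ v | toℕ v <? toℕ u
  ... | yes p | yes q = contradiction q (<-asym p)
  ... | yes p | no _ = refl
  ... | no _ | yes q rewrite adj-sym G u v = +-identityʳ _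
  ... | no p | no q with refl ← Fin.toℕ-injective (≤-antisym (≮⇒≥ q) (≮⇒≥ p)) rewrite adj-irrefl G u = refl

-- Growing trees

-- Freshness is stored at each step, so the vertices are distinct by construction, as the
-- injectivity in `Cycle` demands.
mutual
  data SimplePath (T : SimpleGraph m) : Fin m → Fin m → Set where
    stop : ∀ u → SimplePath T u u
    cons : ∀ {u v w} → u ∼[ T ] v → (p : SimplePath T v w) → Fresh u p → SimplePath T u w

  Fresh : {T : SimpleGraph m} {u w : Fin m} → Fin m → SimplePath T u w → Set
  Fresh x (stop u) = x ≢ u
  Fresh x (cons {u} _ p _) = x ≢ u × Fresh x p

∼-sym : (G : SimpleGraph n) {u v : Fin n} → u ∼[ G ] v → v ∼[ G ] u
∼-sym G {u} {v} = trans (adj-sym G v u)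

∼⇒≢ : (G : SimpleGraph n) {u v : Fin n} → u ∼[ G ] v → u ≢ v
∼⇒≢ G e refl = true≢false e (adj-irrefl G _)

module _ {T : SimpleGraph m} where
  mutual
    snoc : ∀ {u w x} (p : SimplePath T u w) → w ∼[ T ] x → Fresh x p → SimplePath T u x
    snoc {x = x} (stop u) e x≢u = cons e (stop x) (x≢u ∘ sym)
    snoc (cons a p f) e (x≢u , fx) = cons a (snoc p e fx) (fresh-snoc p e fx f (x≢u ∘ sym))

    fresh-snoc : ∀ {u w x z} (p : SimplePath T u w) (e : w ∼[ T ] x) (fx : Fresh x p) →
      Fresh z p → z ≢ x → Fresh z (snoc p e fx)
    fresh-snoc (stop u) e fx z≢u z≢x = z≢u , z≢x
    fresh-snoc (cons a p f) e (_ , fx) (z≢u , fz) z≢x = z≢u , fresh-snoc p e fx fz z≢x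

  len : ∀ {u w} → SimplePath T u w → ℕ
  len (stop _) = 0
  len (cons _ p _) = suc (len p)

  vertex : ∀ {u w} (p : SimplePath T u w) → Fin (suc (len p)) → Fin m
  vertex (stop u) _ = u
  vertex (cons {u} _ p _) Fin.zero = u
  vertex (cons _ p _) (Fin.suc i) = vertex p i

  vertex-first : ∀ {u w} (p : SimplePath T u w) → vertex p Fin.zero ≡ u
  vertex-first (stop _) = refl
  vertex-first (cons _ _ _) = refl

  vertex-last : ∀ {u w} (p : SimplePath T u w) → vertex p (fromℕ (len p)) ≡ w
  vertex-last (stop _) = refl
  vertex-last (cons _ p _) = vertex-last p

  vertex-adj : ∀ {u w} (p : SimplePath T u w) (i : Fin (len p)) → vertex p (inject₁ i) ∼[ T ] vertex p (Fin.suc i)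
  vertex-adj (cons {u} a p _) Fin.zero = subst (λ z → u ∼[ T ] z) (sym (vertex-first p)) a
  vertex-adj (cons _ p _) (Fin.suc i) = vertex-adj p i

  fresh⇒≢ : ∀ {u w x} (p : SimplePath T u w) → Fresh x p → ∀ i → x ≢ vertex p i
  fresh⇒≢ (stop u) x≢u _ = x≢u
  fresh⇒≢ (cons _ p _) (x≢u , _) Fin.zero = x≢u
  fresh⇒≢ (cons _ p _) (_ , fx) (Fin.suc i) = fresh⇒≢ p fx i

  vertex-injective : ∀ {u w} (p : SimplePath T u w) {i j} → vertex p i ≡ vertex p j → i ≡ j
  vertex-injective (stop _) {Fin.zero} {Fin.zero} _ = refl
  vertex-injective (cons _ p f) {Fin.zero} {Fin.zero} _ = refl
  vertex-injective (cons _ p f) {Fin.zero} {Fin.suc j} eq = contradiction eq (fresh⇒≢ p f j)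
  vertex-injective (cons _ p f) {Fin.suc i} {Fin.zero} eq = contradiction (sym eq) (fresh⇒≢ p f i)
  vertex-injective (cons _ p f) {Fin.suc i} {Fin.suc j} eq = cong Fin.suc (vertex-injective p eq)

  -- `u ≢ w` forces `p` to have an edge, so the path prolonged by `v` has at least three vertices;
  -- `j` counts those beyond three.
  closePath : ∀ {u v w} (p : SimplePath T u w) → u ≢ w → Fresh v p → v ∼[ T ] u → w ∼[ T ] v → Cycle T
  closePath (stop _) u≢w _ _ _ = contradiction refl u≢w
  closePath {v = v} p@(cons _ p′ _) _ fv vu wv = record
    { j = len p′
    ; f = vertex whole
    ; f-inj = vertex-injective whole
    ; f-adj = vertex-adj whole
    ; f-close = subst (λ z → z ∼[ T ] v) (sym (vertex-last whole)) wv
    }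
    where whole = cons vu p fv

-- A search order from `y` in which every vertex is attached to an earlier one. It serves to count
-- edges, to find a leaf and to order the greedy embedding.
data Grown (T : SimpleGraph m) (y : Fin m) : ℕ → (Fin m → Bool) → Set where
  start : Grown T y 0 (_== y)
  grow : ∀ {s P} → Grown T y s P → ∀ u v → P u ≡ true → P v ≡ false → u ∼[ T ] v → Grown T y (suc s) (P ∪ˢ v)

∪ˢ-old : (P : Fin m → Bool) {v x : Fin m} → P x ≡ true → (P ∪ˢ v) x ≡ true
∪ˢ-old P e rewrite e = refl

∪ˢ-new : (P : Fin m → Bool) (v : Fin m) → (P ∪ˢ v) v ≡ true
∪ˢ-new P v rewrite ==-refl v with P v
... | true = refl
... | false = refl

∪ˢ-elim : (P : Fin m → Bool) (v x : Fin m) → (P ∪ˢ v) x ≡ true → P x ≡ true ⊎ x ≡ v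
∪ˢ-elim P v x e with P x
... | true = inj₁ refl
... | false = inj₂ (==⇒≡ e)

∪ˢ-false : (P : Fin m → Bool) (v x : Fin m) → (P ∪ˢ v) x ≡ false → P x ≡ false × x ≢ v
∪ˢ-false P v x e with P x | x Fin.≟ v
... | false | no x≢v = refl , x≢v

member≢ : (P : Fin m → Bool) {u v : Fin m} → P u ≡ true → P v ≡ false → u ≢ v
member≢ P Pu Pv refl = true≢false Pu Pv

module _ {T : SimpleGraph m} {y : Fin m} where
  -- The second component says that the path stays inside `P`, in the form needed to close it
  -- through a vertex outside `P`. A new vertex prolongs the path at its parent.
  grown-path : ∀ {s P} → Grown T y s P → ∀ a b → P a ≡ true → P b ≡ true →
    Σ (SimplePath T a b) λ p → ∀ x → P x ≡ false → Fresh x p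
  grown-path start a b Pa Pb with refl ← ==⇒≡ {i = a} {y} Pa | refl ← ==⇒≡ {i = b} {y} Pb =
    stop y , λ x Px x≡y → true≢false Pa (trans (cong (_== y) (sym x≡y)) Px)
  grown-path (grow {P = P} g u v Pu Pv uv) a b Pa Pb with ∪ˢ-elim P v a Pa | ∪ˢ-elim P v b Pb
  ... | inj₁ Pa′ | inj₁ Pb′ with grown-path g a b Pa′ Pb′
  ...   | p , fresh = p , λ x Px → fresh x (proj₁ (∪ˢ-false P v x Px))
  grown-path (grow {P = P} g u v Pu Pv uv) a b Pa Pb | inj₁ Pa′ | inj₂ refl with grown-path g a u Pa′ Pu
  ...   | p , fresh = snoc p uv (fresh v Pv) , λ x Px →
            fresh-snoc p uv (fresh v Pv) (fresh x (proj₁ (∪ˢ-false P v x Px))) (proj₂ (∪ˢ-false P v x Px))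
  grown-path (grow {P = P} g u v Pu Pv uv) a b Pa Pb | inj₂ refl | inj₁ Pb′ with grown-path g u b Pu Pb′
  ...   | p , fresh = cons (∼-sym T uv) p (fresh v Pv) , λ x Px →
            proj₂ (∪ˢ-false P v x Px) , fresh x (proj₁ (∪ˢ-false P v x Px))
  grown-path (grow {P = P} g u v Pu Pv uv) a b Pa Pb | inj₂ refl | inj₂ refl =
    stop v , λ x Px → proj₂ (∪ˢ-false P v x Px)

  -- Two distinct neighbours of `v` in `P` are joined by a path inside `P`, which `v` would close to
  -- a cycle.
  unique-parent : Acyclic T → ∀ {s P} → Grown T y s P → ∀ {u u′ v} → P u ≡ true → P u′ ≡ true → P v ≡ false →
    u ∼[ T ] v → u′ ∼[ T ] v → u′ ≡ u
  unique-parent acyclic g {u} {u′} {v} Pu Pu′ Pv uv u′v with u′ Fin.≟ u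
  ... | yes eq = eq
  ... | no u′≢u with grown-path g u′ u Pu′ Pu
  ...   | p , fresh = contradiction (closePath p u′≢u (fresh v Pv) (∼-sym T u′v) uv) acyclic

  -- Each added vertex has exactly one neighbour in `P`, hence brings two ordered pairs. This ties
  -- the number of steps to the number of edges.
  grown-edges : Acyclic T → ∀ {s P} → Grown T y s P → ∑∑ P (adj T) ≡ 2 * s
  grown-edges acyclic start =
    trans (sum-pick y (row (_== y) (adj T)))
      (trans (sum-pick y (λ v → ⟦ adj T y v ⟧)) (cong ⟦_⟧ (adj-irrefl T y)))
  grown-edges acyclic (grow {s} {P} g u v Pu Pv uv) = begin
    ∑∑ (P ∪ˢ v) (adj T)
      ≡⟨ ∑∑-split (P ∪ˢ v) P (adj T) (adj-sym T) (split-∪ˢ P Pv) ⟩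
    ∑∑ P (adj T) + (2 * row P (adj T) v + ⟦ adj T v v ⟧)
      ≡⟨ cong₂ _+_ (grown-edges acyclic g) (cong₂ (λ p q → 2 * p + ⟦ q ⟧) oneParent (adj-irrefl T v)) ⟩
    2 * s + 2
      ≡⟨ trans (+-comm (2 * s) 2) (sym (*-suc 2 s)) ⟩
    2 * suc s ∎
    where
    open ≡-Reasoning
    ∧⇒* : ∀ b c → ⟦ b ⟧ * ⟦ c ⟧ ≡ ⟦ b ∧ c ⟧
    ∧⇒* true c = +-identityʳ _
    ∧⇒* false c = refl
    parent? : Fin m → Bool
    parent? w = P w ∧ adj T v w
    parent?-elim : ∀ w → parent? w ≡ true → P w ≡ true × v ∼[ T ] w
    parent?-elim w e with P w
    ... | true = refl , e
    oneParent : row P (adj T) v ≡ 1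
    oneParent = trans (sum-cong-≗ {m} λ w → ∧⇒* (P w) (adj T v w))
      (∣∣-unique parent? {u} (cong₂ _∧_ Pu (∼-sym T uv))
        λ w e → unique-parent acyclic g Pu (proj₁ (parent?-elim w e)) Pv uv (∼-sym T (proj₂ (parent?-elim w e))))

  -- R is the set still to be covered; a vertex outside R must be a dead end for walks leaving P.
  exit-edge : (P R : Fin m → Bool) → (∀ b c → R b ≡ false → b ∼[ T ] c → P c ≡ true) →
    ∀ {a x} → Walk T a x → P a ≡ true → P x ≡ false → R x ≡ true →
    ∃[ u ] ∃[ v ] (P u ≡ true × P v ≡ false × R v ≡ true × u ∼[ T ] v)
  exit-edge P R dead here Pa Px Rx = contradiction Px (true≢false Pa)
  exit-edge P R dead (step {a} {b} e w) Pa Px Rx with P b in Pb | R b in Rb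
  ... | true | _ = exit-edge P R dead w Pb Px Rx
  ... | false | true = a , b , Pa , Pb , Rb , e
  exit-edge P R dead (step e here) Pa Px Rx | false | false = contradiction Rb (true≢false Rx)
  exit-edge P R dead (step e (step {v = c} e′ w)) Pa Px Rx | false | false =
    exit-edge P R dead w (dead _ c Rb e′) Px Rx

  -- Needed twice: with `R` everything, to find a last vertex, and with `R` everything but that
  -- leaf. The condition on dead ends is restricted to sets containing `y`, since `y` will be the
  -- leaf's only neighbour. The fuel `t` bounds the number of vertices outside `P`.
  grow-to : Connected T → (R : Fin m → Bool) →
    (∀ P → P y ≡ true → ∀ b c → R b ≡ false → b ∼[ T ] c → P c ≡ true) →
    ∀ t {s P} → Grown T y s P → P y ≡ true → (∀ x → P x ≡ true → R x ≡ true) → m ≤ t + ∣ P ∣ →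
    ∃[ s′ ] ∃[ P′ ] (Grown T y s′ P′ × (∀ x → P′ x ≡ true → R x ≡ true) × (∀ x → R x ≡ true → P′ x ≡ true))
  grow-to conn R dead t {s} {P} g Py P⊆R fuel with Fin.any? (λ x → (P x Bool.≟ false) ×-dec (R x Bool.≟ true))
  ... | no none = s , P , g , P⊆R , λ x Rx → covered x Rx
    where
    covered : ∀ x → R x ≡ true → P x ≡ true
    covered x Rx with P x in Px
    ... | true = refl
    ... | false = contradiction (x , Px , Rx) none
  ... | yes (x , Px , Rx) with exit-edge P R (dead P Py) (conn y x) Py Px Rx
  ... | u , v , Pu , Pv , Rv , uv with t
  ...   | zero = contradiction (≤-trans (≤-reflexive (sym (∣∣-split (P ∪ˢ v) P (split-∪ˢ P Pv)))) (∣∣≤n (P ∪ˢ v))) (<⇒≱ (s≤s fuel))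
  ...   | suc t′ = grow-to conn R dead t′ (grow g u v Pu Pv uv) (∪ˢ-old P Py) inR
            (≤-trans fuel (≤-reflexive (trans (sym (+-suc t′ ∣ P ∣)) (cong (t′ +_) (sym (∣∣-split (P ∪ˢ v) P (split-∪ˢ P Pv)))))))
    where
    inR : ∀ z → (P ∪ˢ v) z ≡ true → R z ≡ true
    inR z Pz with ∪ˢ-elim P v z Pz
    ... | inj₁ Pz′ = P⊆R z Pz′
    ... | inj₂ refl = Rv

-- Rainbow embeddings

-- The last vertex `ℓ` of a growth covering `T` is a leaf: all other vertices came earlier, and
-- `unique-parent` leaves only `y` as its neighbour. Growing again from `y` while avoiding `ℓ` gives
-- an order that begins where the rich vertex will be used.
leaf-ordering : (T : SimpleGraph m) → IsTree T → edgeCount T ≡ suc k →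
  ∃[ y ] ∃[ ℓ ] ∃[ P ] (Grown T y k P × P y ≡ true × P ℓ ≡ false × y ∼[ T ] ℓ × (∀ x → P x ≡ true ⊎ x ≡ ℓ))
leaf-ordering {zero} T tree edges with () ← trans (sym edges) (edgeCount-sum T)
leaf-ordering {suc m} {k} T (conn , acyclic) edges
  with grow-to {y = Fin.zero} conn Full (λ _ _ _ _ ()) (suc m) start refl (λ _ _ → refl) (m≤m+n (suc m) _)
-- A growth without steps covers a single vertex, and then there is no edge.
... | .0 , _ , start , _ , full = contradiction (trans (sym twoEdges) noEdges) λ ()
  where
  noEdges : ∑∑ Full (adj T) ≡ 0
  noEdges = trans (sum-cong-≗ {suc m} λ u → cong₂ (λ p q → ⟦ p ⟧ * q) (sym (full u refl))
      (sum-cong-≗ {suc m} λ v → cong (λ p → ⟦ p ⟧ * ⟦ adj T u v ⟧) (sym (full v refl))))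
    (grown-edges {y = Fin.zero} acyclic start)
  twoEdges : ∑∑ Full (adj T) ≡ 2 * suc k
  twoEdges = trans (handshake T) (cong (2 *_) edges)
... | _ , _ , grow {P = P₀} g y ℓ P₀y P₀ℓ yℓ , _ , full
  with grow-to {y = y} conn rest dead (suc m) start (==-refl y) y∈rest (m≤m+n (suc m) _)
  where
  rest : Fin (suc m) → Bool
  rest x = not (x == ℓ)
  y∈rest : ∀ x → x == y ≡ true → rest x ≡ true
  y∈rest x e with refl ← ==⇒≡ {i = x} {y} e = cong not (≢⇒== (∼⇒≢ T yℓ))
  dead : ∀ P → P y ≡ true → ∀ b c → rest b ≡ false → b ∼[ T ] c → P c ≡ true
  dead P Py b c e bc with b Fin.≟ ℓ
  ... | yes refl with ∪ˢ-elim P₀ ℓ c (full c refl)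
  ...   | inj₂ refl = contradiction refl (∼⇒≢ T bc)
  ...   | inj₁ P₀c with refl ← unique-parent acyclic g P₀y P₀c P₀ℓ yℓ (∼-sym T bc) = Py
... | s , P , grown , P⊆rest , rest⊆P = y , ℓ , P , subst (λ z → Grown T y z P) s≡k grown , Py , Pℓ , yℓ , cover
  where
  Pℓ : P ℓ ≡ false
  Pℓ = ≢true⇒false λ e → true≢false (P⊆rest ℓ e) (cong not (==-refl ℓ))
  cover : ∀ x → P x ≡ true ⊎ x ≡ ℓ
  cover x with x Fin.≟ ℓ
  ... | yes eq = inj₂ eq
  ... | no x≢ℓ = inj₁ (rest⊆P x (cong not (≢⇒== x≢ℓ)))
  Py : P y ≡ true
  Py = rest⊆P y (cong not (≢⇒== (∼⇒≢ T yℓ)))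
  everything : ∀ x → (P ∪ˢ ℓ) x ≡ true
  everything x with cover x
  ... | inj₁ e = ∪ˢ-old P e
  ... | inj₂ refl = ∪ˢ-new P ℓ
  -- Putting `ℓ` back gives a growth of `suc s` steps over all vertices, so `suc s` is the number of
  -- edges.
  s≡k : s ≡ k
  s≡k = suc-injective (*-cancelˡ-≡ (suc s) (suc k) 2
    (trans (sym (grown-edges acyclic (grow grown y ℓ Py Pℓ yℓ)))
      (trans (sum-cong-≗ {suc m} λ u → cong₂ (λ p q → ⟦ p ⟧ * q) (everything u)
          (sum-cong-≗ {suc m} λ v → cong (λ p → ⟦ p ⟧ * ⟦ adj T u v ⟧) (everything v)))
        (trans (handshake T) (cong (2 *_) edges)))))

-- `φ` is total, so its values at unplaced vertices are avoided too. There are at most `m` values in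
-- all, which is where the threshold `suc m` for low degrees comes from.
new-neighbour : (G : SimpleGraph n) (W : Fin n → Bool) (u : Fin n) (φ : Fin m → Fin n) → suc m ≤ deg G W u →
  ∃[ x ] (W x ≡ true × u ∼[ G ] x × (∀ a → φ a ≢ x))
new-neighbour {n} {m} G W u φ big
  with Fin.any? (λ x → (W x Bool.≟ true) ×-dec ((adj G u x Bool.≟ true) ×-dec Fin.all? (λ a → ¬? (φ a Fin.≟ x))))
... | yes r = r
... | no none = contradiction big (≤⇒≯ (begin
    deg G W u                                     ≤⟨ sum-mono-≤ hit ⟩
    ∑[ x < n ] ∑[ a < m ] ⟦ x == φ a ⟧            ≡⟨ ∑-comm {n} {m} (λ x a → ⟦ x == φ a ⟧) ⟩
    ∑[ a < m ] ∣ (_== φ a) ∣                      ≡⟨ sum-cong-≗ {m} (λ a → ∣∣-singleton (φ a)) ⟩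
    ∑[ a < m ] 1                                  ≡⟨ ∣∣-full m ⟩
    m ∎))
  where
  open ≤-Reasoning
  hit : ∀ x → ⟦ W x ⟧ * ⟦ adj G u x ⟧ ≤ ∑[ a < m ] ⟦ x == φ a ⟧
  hit x with W x in Wx | adj G u x in ux | Fin.any? (λ a → φ a Fin.≟ x)
  ... | false | _ | _ = z≤n
  ... | true | false | _ = z≤n
  ... | true | true | yes (a , refl) =
        ≤-trans (≤-reflexive (cong ⟦_⟧ (sym (==-refl (φ a))))) (term≤sum (λ a′ → ⟦ φ a == φ a′ ⟧) a)
  ... | true | true | no miss = contradiction (x , Wx , ux , λ a eq → miss (a , eq)) none

-- Total maps with conditions only on `P`, so that an extension is a pointwise update. `rainbow`
-- allows the reversed pair because edges appear here in both orientations; `used` is kept as a set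
-- so that its size can be compared with the number of steps.
record Partial (𝒢 : GraphSystem k n) (T : SimpleGraph m) (P : Fin m → Bool) : Set where
  field
    φ : Fin m → Fin n
    ψ : Fin m → Fin m → Fin k
    used : Fin k → Bool
    φ-injective : ∀ a b → P a ≡ true → P b ≡ true → φ a ≡ φ b → a ≡ b
    coloured : ∀ a b → P a ≡ true → P b ≡ true → a ∼[ T ] b → φ a ∼[ 𝒢 (ψ a b) ] φ b
    ψ-used : ∀ a b → P a ≡ true → P b ≡ true → a ∼[ T ] b → used (ψ a b) ≡ true
    rainbow : ∀ a b c d → P a ≡ true → P b ≡ true → P c ≡ true → P d ≡ true → a ∼[ T ] b → c ∼[ T ] d →
      ψ a b ≡ ψ c d → (a ≡ c × b ≡ d) ⊎ (a ≡ d × b ≡ c)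
open Partial

update : {A : Set} → (Fin m → A) → Fin m → A → Fin m → A
update f v x a = if a == v then x else f a

update-at : {A : Set} (f : Fin m → A) (v : Fin m) (x : A) → update f v x v ≡ x
update-at f v x rewrite ==-refl v = refl

update-other : {A : Set} (f : Fin m → A) {v a : Fin m} (x : A) → a ≢ v → update f v x a ≡ f a
update-other f x a≢v rewrite ≢⇒== a≢v = refl

extend : {𝒢 : GraphSystem k n} {T : SimpleGraph m} {P : Fin m → Bool} (E : Partial 𝒢 T P) {u v : Fin m} →
  P u ≡ true → P v ≡ false → (∀ u′ → P u′ ≡ true → u′ ∼[ T ] v → u′ ≡ u) →
  {c : Fin k} → used E c ≡ false → {x : Fin n} → φ E u ∼[ 𝒢 c ] x → (∀ a → φ E a ≢ x) →
  Σ (Partial 𝒢 T (P ∪ˢ v)) λ E′ →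
    (∣ used E′ ∣ ≡ suc ∣ used E ∣) × φ E′ v ≡ x × (∀ a → a ≢ v → φ E′ a ≡ φ E a)
extend {k} {n} {m} {𝒢} {T} {P} E {u} {v} Pu Pv parent {c} unused {x} ux fresh =
  record
    { φ = φ′ ; ψ = ψ′ ; used = used E ∪ˢ c
    ; φ-injective = injective ; coloured = coloured′ ; ψ-used = used′ ; rainbow = rainbow′ }
  , ∣∣-split (used E ∪ˢ c) (used E) (split-∪ˢ (used E) unused) , update-at (φ E) v x , λ a → update-other (φ E) x
  where
  φ′ : Fin m → Fin n
  φ′ = update (φ E) v x
  -- Every pair meeting `v` gets `c`; among the vertices placed so far, only the pair with `u` is an
  -- edge.
  ψ′ : Fin m → Fin m → Fin k
  ψ′ a = if a == v then (λ _ → c) else update (ψ E a) v c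

  data View : Fin m → Set where
    new : View v
    old : ∀ {a} → P a ≡ true → a ≢ v → View a

  view : ∀ a → (P ∪ˢ v) a ≡ true → View a
  view a e with ∪ˢ-elim P v a e
  ... | inj₁ Pa = old Pa (member≢ P Pa Pv)
  ... | inj₂ refl = new

  φ-new : φ′ v ≡ x
  φ-new = update-at (φ E) v x
  φ-old : ∀ {a} → a ≢ v → φ′ a ≡ φ E a
  φ-old = update-other (φ E) x
  ψ-newˡ : ∀ b → ψ′ v b ≡ c
  ψ-newˡ b rewrite ==-refl v = refl
  ψ-newʳ : ∀ {a} → a ≢ v → ψ′ a v ≡ c
  ψ-newʳ {a} a≢v rewrite ≢⇒== a≢v = update-at (ψ E a) v c
  ψ-old : ∀ {a b} → a ≢ v → b ≢ v → ψ′ a b ≡ ψ E a b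
  ψ-old {a} a≢v b≢v rewrite ≢⇒== a≢v = update-other (ψ E a) c b≢v

  injective : ∀ a b → (P ∪ˢ v) a ≡ true → (P ∪ˢ v) b ≡ true → φ′ a ≡ φ′ b → a ≡ b
  injective a b a∈ b∈ eq with view a a∈ | view b b∈
  ... | new | new = refl
  ... | new | old _ b≢v = contradiction (trans (sym (φ-old b≢v)) (trans (sym eq) φ-new)) (fresh b)
  ... | old _ a≢v | new = contradiction (trans (sym (φ-old a≢v)) (trans eq φ-new)) (fresh a)
  ... | old Pa a≢v | old Pb b≢v = φ-injective E a b Pa Pb (trans (sym (φ-old a≢v)) (trans eq (φ-old b≢v)))

  coloured′ : ∀ a b → (P ∪ˢ v) a ≡ true → (P ∪ˢ v) b ≡ true → a ∼[ T ] b → φ′ a ∼[ 𝒢 (ψ′ a b) ] φ′ b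
  coloured′ a b a∈ b∈ ab with view a a∈ | view b b∈
  ... | new | new = contradiction refl (∼⇒≢ T ab)
  ... | new | old Pb b≢v rewrite ψ-newˡ b | φ-new | φ-old b≢v | parent b Pb (∼-sym T ab) = ∼-sym (𝒢 c) ux
  ... | old Pa a≢v | new rewrite ψ-newʳ a≢v | φ-new | φ-old a≢v | parent a Pa ab = ux
  ... | old Pa a≢v | old Pb b≢v rewrite ψ-old a≢v b≢v | φ-old a≢v | φ-old b≢v = coloured E a b Pa Pb ab

  used′ : ∀ a b → (P ∪ˢ v) a ≡ true → (P ∪ˢ v) b ≡ true → a ∼[ T ] b → (used E ∪ˢ c) (ψ′ a b) ≡ true
  used′ a b a∈ b∈ ab with view a a∈ | view b b∈
  ... | new | _ rewrite ψ-newˡ b = ∪ˢ-new (used E) c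
  ... | old Pa a≢v | new rewrite ψ-newʳ a≢v = ∪ˢ-new (used E) c
  ... | old Pa a≢v | old Pb b≢v rewrite ψ-old a≢v b≢v = ∪ˢ-old (used E) (ψ-used E a b Pa Pb ab)

  old≢c : ∀ {a b} → P a ≡ true → P b ≡ true → a ∼[ T ] b → ψ E a b ≢ c
  old≢c Pa Pb ab eq = true≢false (ψ-used E _ _ Pa Pb ab) (trans (cong (used E) eq) unused)

  rainbow′ : ∀ a b p q → (P ∪ˢ v) a ≡ true → (P ∪ˢ v) b ≡ true → (P ∪ˢ v) p ≡ true → (P ∪ˢ v) q ≡ true →
    a ∼[ T ] b → p ∼[ T ] q → ψ′ a b ≡ ψ′ p q → (a ≡ p × b ≡ q) ⊎ (a ≡ q × b ≡ p)
  rainbow′ a b p q a∈ b∈ p∈ q∈ ab pq eq with view a a∈ | view b b∈ | view p p∈ | view q q∈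
  ... | new | new | _ | _ = contradiction refl (∼⇒≢ T ab)
  ... | _ | _ | new | new = contradiction refl (∼⇒≢ T pq)
  ... | new | old Pb _ | new | old Pq _ =
        inj₁ (refl , trans (parent b Pb (∼-sym T ab)) (sym (parent q Pq (∼-sym T pq))))
  ... | new | old Pb _ | old Pp _ | new =
        inj₂ (refl , trans (parent b Pb (∼-sym T ab)) (sym (parent p Pp pq)))
  ... | old Pa _ | new | new | old Pq _ =
        inj₂ (trans (parent a Pa ab) (sym (parent q Pq (∼-sym T pq))) , refl)
  ... | old Pa _ | new | old Pp _ | new =
        inj₁ (trans (parent a Pa ab) (sym (parent p Pp pq)) , refl)
  ... | new | old _ _ | old Pp p≢v | old Pq q≢v =
        contradiction (trans (sym (ψ-old p≢v q≢v)) (trans (sym eq) (ψ-newˡ b))) (old≢c Pp Pq pq)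
  ... | old _ a≢v | new | old Pp p≢v | old Pq q≢v =
        contradiction (trans (sym (ψ-old p≢v q≢v)) (trans (sym eq) (ψ-newʳ a≢v))) (old≢c Pp Pq pq)
  ... | old Pa a≢v | old Pb b≢v | new | old _ _ =
        contradiction (trans (sym (ψ-old a≢v b≢v)) (trans eq (ψ-newˡ q))) (old≢c Pa Pb ab)
  ... | old Pa a≢v | old Pb b≢v | old _ p≢v | new =
        contradiction (trans (sym (ψ-old a≢v b≢v)) (trans eq (ψ-newʳ p≢v))) (old≢c Pa Pb ab)
  ... | old Pa a≢v | old Pb b≢v | old Pp p≢v | old Pq q≢v =
        rainbow E a b p q Pa Pb Pp Pq ab pq (trans (sym (ψ-old a≢v b≢v)) (trans eq (ψ-old p≢v q≢v)))

complete : {𝒢 : GraphSystem k n} {T : SimpleGraph m} {P : Fin m → Bool} → (∀ x → P x ≡ true) →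
  Partial 𝒢 T P → RainbowCopy 𝒢 T
complete {T = T} full E = record
  { φ = φ E
  ; φ-inj = φ-injective E _ _ (full _) (full _)
  ; ψ = ψ E
  ; ψ-ok = λ u v _ uv → coloured E u v (full u) (full v) uv
  ; ψ-inj = inj
  }
  where
  inj : ∀ u v u' v' → toℕ u < toℕ v → u ∼[ T ] v → toℕ u' < toℕ v' → u' ∼[ T ] v' →
    ψ E u v ≡ ψ E u' v' → u ≡ u' × v ≡ v'
  inj u v u' v' u<v uv u'<v' u'v' eq
    with rainbow E u v u' v' (full u) (full v) (full u') (full v') uv u'v' eq
  ... | inj₁ same = same
  -- A reversed pair contradicts the orientation by `toℕ`.
  ... | inj₂ (refl , refl) = contradiction u'<v' (<-asym u<v)

two-unused : (U : Fin k → Bool) → 2 + ∣ U ∣ ≤ k → ∃[ c ] ∃[ d ] (c ≢ d × U c ≡ false × U d ≡ false)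
two-unused {k} U room with ∣∣<⇒missing U (≤-trans (n≤1+n _) room)
... | c , Uc with ∣∣<⇒missing (U ∪ˢ c) (≤-trans (≤-reflexive (cong suc (∣∣-split (U ∪ˢ c) U (split-∪ˢ U Uc)))) room)
...   | d , Ud with ∪ˢ-false U c d Ud
...     | Ud′ , d≢c = c , d , d≢c ∘ sym , Uc , Ud′

-- All of T but a leaf at y is placed inside the trimmed set, where two unused colours always
-- leave one that the current vertex is rich in; the remaining edge gets the last colour at the rich vertex.
module _ {𝒢 : GraphSystem (suc k) n} {T : SimpleGraph m} (acyclic : Acyclic T)
  (W : Fin n → Bool) (trimmed : Trimmed (suc m) 𝒢 W) {z : Fin n} (Wz : W z ≡ true) (y : Fin m) where

  embed : ∀ {s P} → Grown T y s P → s ≤ k →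
    Σ (Partial 𝒢 T P) λ E → ∣ used E ∣ ≡ s × φ E y ≡ z × P y ≡ true × (∀ a → P a ≡ true → W (φ E a) ≡ true)
  embed start _ = record
      { φ = λ _ → z
      -- An arbitrary colour: a single vertex spans no edge.
      ; ψ = λ _ _ → Fin.zero
      ; used = λ _ → false
      ; φ-injective = λ a b Pa Pb _ → trans (==⇒≡ {i = a} {y} Pa) (sym (==⇒≡ {i = b} {y} Pb))
      ; coloured = λ a b Pa Pb ab → no-edge a b Pa Pb ab
      ; ψ-used = λ a b Pa Pb ab → no-edge a b Pa Pb ab
      ; rainbow = λ a b _ _ Pa Pb _ _ ab _ _ → no-edge a b Pa Pb ab }
    , sum-zero {suc k} (λ _ → refl) , refl , ==-refl y , λ _ _ → Wz
    where
    no-edge : {A : Set} → ∀ a b → a == y ≡ true → b == y ≡ true → a ∼[ T ] b → A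
    no-edge a b Pa Pb ab = contradiction (trans (==⇒≡ {i = a} {y} Pa) (sym (==⇒≡ {i = b} {y} Pb))) (∼⇒≢ T ab)
  embed (grow {s} {P} g u v Pu Pv uv) s<k with embed g (<⇒≤ s<k)
  -- Of the `suc k` colours `s` are used, and `s < k`, so two are free.
  ... | E , size , φy , Py , inW with two-unused (used E) (≤-trans (≤-reflexive (cong (2 +_) size)) (s≤s s<k))
  ... | c , d , c≢d , Uc , Ud with good
    where
    good : ∃[ e ] (used E e ≡ false × suc m ≤ deg (𝒢 e) W (φ E u))
    good with suc m ≤? deg (𝒢 c) W (φ E u) | suc m ≤? deg (𝒢 d) W (φ E u)
    ... | yes p | _ = c , Uc , p
    ... | no _ | yes p = d , Ud , p
    ... | no p | no q = contradiction (c , d , c≢d , ≰⇒> p , ≰⇒> q) (trimmed (φ E u) (inW u Pu))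
  ... | e , Ue , big with new-neighbour (𝒢 e) W (φ E u) (φ E) big
  ... | x , Wx , ux , fresh with extend E Pu Pv (λ u′ Pu′ u′v → unique-parent acyclic g Pu Pu′ Pv uv u′v) Ue ux fresh
  ... | E′ , size′ , new , old =
      E′ , trans size′ (cong suc size) , trans (old y (member≢ P Py Pv)) φy , ∪ˢ-old P Py , inW′
    where
    inW′ : ∀ a → (P ∪ˢ v) a ≡ true → W (φ E′ a) ≡ true
    inW′ a a∈ with ∪ˢ-elim P v a a∈
    ... | inj₁ Pa = trans (cong W (old a (member≢ P Pa Pv))) (inW a Pa)
    ... | inj₂ refl = trans (cong W new) Wx

rainbow-tree : (T : SimpleGraph m) → IsTree T → edgeCount T ≡ suc k → (𝒢 : GraphSystem (suc k) n) → 0 < n →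
  (∀ i → EdgeDense (suc k) (suc m) (𝒢 i)) → RainbowCopy 𝒢 T
rainbow-tree {m} {k} {n} T tree@(_ , acyclic) edges 𝒢 n>0 edgeDense
  with trim (suc m) 𝒢 n Full (∣∣-full n) (dense-start (suc m) 𝒢 edgeDense)
... | W , dense , trimmed with rich-vertex m 𝒢 edgeDense n>0 W dense trimmed
... | z , Wz , rich with leaf-ordering T tree edges
... | y , ℓ , P , g , Py , Pℓ , yℓ , cover with embed acyclic W trimmed Wz y g ≤-refl
-- Exactly one colour is left, and which one is not controlled; this is why `rich` covers all
-- colours.
... | E , size , φy , _ , _ with ∣∣<⇒missing (used E) (s≤s (≤-reflexive size))
... | c , Uc with new-neighbour (𝒢 c) Full (φ E y) (φ E) (subst (λ w → suc m ≤ deg (𝒢 c) Full w) (sym φy) (rich c))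
... | x , _ , yx , fresh
  with extend E Py Pℓ (λ u′ Pu′ u′ℓ → unique-parent acyclic g Py Pu′ Pℓ yℓ u′ℓ) Uc yx fresh
... | E′ , _ = complete everything E′
  where
  everything : ∀ a → (P ∪ˢ ℓ) a ≡ true
  everything a with cover a
  ... | inj₁ Pa = ∪ˢ-old P Pa
  ... | inj₂ refl = ∪ˢ-new P ℓ

-- Densities

open import Data.Integer using (+_)

-- In unnormalised rationals an inequality is its cross-multiplied form, so the density bounds
-- reduce to natural numbers.
toℚᵘ-/ : ∀ i d → ℚ.toℚᵘ (i ℚ./ suc d) ℚᵘ.≃ mkℚᵘ i d
toℚᵘ-/ i d = ℚ.toℚᵘ-fromℚᵘ (mkℚᵘ i d)

toℚᵘ-starDensity : ∀ k → ℚ.toℚᵘ (starDensity (suc k)) ℚᵘ.≃ mkℚᵘ (+ k) k ℚᵘ.* mkℚᵘ (+ k) k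
toℚᵘ-starDensity k = ℚᵘ.≃-trans (ℚ.toℚᵘ-homo-* (+ k ℚ./ suc k) (+ k ℚ./ suc k))
  (ℚᵘ.*-cong (toℚᵘ-/ (+ k) k) (toℚᵘ-/ (+ k) k))

toℚᵘ-bound : ∀ k ε M {εᵘ} → ℚ.toℚᵘ ε ℚᵘ.≃ εᵘ →
  ℚ.toℚᵘ ((starDensity (suc k) ℚ.+ ε) ℚ.* toℚ M) ℚᵘ.≃ (mkℚᵘ (+ k) k ℚᵘ.* mkℚᵘ (+ k) k ℚᵘ.+ εᵘ) ℚᵘ.* mkℚᵘ (+ M) 0
toℚᵘ-bound k ε M ε≃ = ℚᵘ.≃-trans (ℚ.toℚᵘ-homo-* (starDensity (suc k) ℚ.+ ε) (toℚ M))
  (ℚᵘ.*-cong (ℚᵘ.≃-trans (ℚ.toℚᵘ-homo-+ (starDensity (suc k)) ε) (ℚᵘ.+-cong (toℚᵘ-starDensity k) ε≃)) (toℚᵘ-/ (+ M) 0))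

≤-density+ε : ∀ k p d {ε} → ℚ.toℚᵘ ε ≡ mkℚᵘ (+ suc p) d → ∀ e M →
  e * (suc k * suc k * suc d) ≤ (k * k * suc d + suc p * (suc k * suc k)) * M →
  toℚ e ℚ.≤ (starDensity (suc k) ℚ.+ ε) ℚ.* toℚ M
≤-density+ε k p d {ε} ε≡ e M h = ℚ.toℚᵘ-cancel-≤
  (ℚᵘ.≤-respˡ-≃ (ℚᵘ.≃-sym (toℚᵘ-/ (+ e) 0)) (ℚᵘ.≤-respʳ-≃ (ℚᵘ.≃-sym (toℚᵘ-bound k ε M (ℚᵘ.≃-reflexive ε≡)))
    (ℚᵘ.*≤* (subst₂ ℤ._≤_ lhs rhs (ℤ.+≤+ h)))))
  where
  K q P : ℕ
  K = suc k
  q = suc d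
  P = suc p
  lhs : + (e * (K * K * q)) ≡ + e ℤ.* + (K * K * q * 1)
  lhs = trans (ℤ.pos-* e (K * K * q)) (cong (λ z → + e ℤ.* + z) (sym (*-identityʳ (K * K * q))))
  rhs : + ((k * k * q + P * (K * K)) * M) ≡ ((+ k ℤ.* + k) ℤ.* + q ℤ.+ + P ℤ.* + (K * K)) ℤ.* + M ℤ.* + 1
  rhs = trans (ℤ.pos-* (k * k * q + P * (K * K)) M)
    (trans (cong (ℤ._* + M) (trans (ℤ.pos-+ (k * k * q) (P * (K * K)))
      (cong₂ ℤ._+_ (trans (ℤ.pos-* (k * k) q) (cong (ℤ._* + q) (ℤ.pos-* k k))) (ℤ.pos-* P (K * K)))))
      (sym (ℤ.*-identityʳ _)))

density-ε≤ : ∀ k p d {ε} → ℚ.toℚᵘ ε ≡ mkℚᵘ (+ suc p) d → ∀ e M →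
  k * k * suc d * M ≤ e * (suc k * suc k * suc d) + suc p * (suc k * suc k) * M →
  (starDensity (suc k) ℚ.- ε) ℚ.* toℚ M ℚ.≤ toℚ e
density-ε≤ k p d {ε} ε≡ e M h = ℚ.toℚᵘ-cancel-≤
  (ℚᵘ.≤-respʳ-≃ (ℚᵘ.≃-sym (toℚᵘ-/ (+ e) 0)) (ℚᵘ.≤-respˡ-≃ (ℚᵘ.≃-sym (toℚᵘ-bound k (ℚ.- ε) M (ℚᵘ.≃-trans (ℚ.toℚᵘ-homo‿- ε) (ℚᵘ.≃-reflexive (cong ℚᵘ.-_ ε≡)))))
    (ℚᵘ.*≤* (subst₂ ℤ._≤_ lhs rhs (ℤ.+-monoˡ-≤ (ℤ.- (+ P ℤ.* + (K * K) ℤ.* + M)) (ℤ.+≤+ h))))))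
  where
  K q P : ℕ
  K = suc k
  q = suc d
  P = suc p
  lhs : + (k * k * q * M) ℤ.+ ℤ.- (+ P ℤ.* + (K * K) ℤ.* + M) ≡
        ((+ k ℤ.* + k) ℤ.* + q ℤ.+ (ℤ.- + P) ℤ.* + (K * K)) ℤ.* + M ℤ.* + 1
  lhs = trans (cong (ℤ._+ ℤ.- (+ P ℤ.* + (K * K) ℤ.* + M))
      (trans (ℤ.pos-* (k * k * q) M) (cong (ℤ._* + M) (trans (ℤ.pos-* (k * k) q) (cong (ℤ._* + q) (ℤ.pos-* k k))))))
    (factor (+ k ℤ.* + k) (+ q) (+ P) (+ (K * K)) (+ M))
    where
    factor : ∀ a q p b c → a ℤ.* q ℤ.* c ℤ.+ ℤ.- (p ℤ.* b ℤ.* c) ≡ (a ℤ.* q ℤ.+ (ℤ.- p) ℤ.* b) ℤ.* c ℤ.* + 1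
    factor = ℤSolver.solve-∀
  rhs : + (e * (K * K * q) + P * (K * K) * M) ℤ.+ ℤ.- (+ P ℤ.* + (K * K) ℤ.* + M) ≡ + e ℤ.* + (K * K * q * 1)
  rhs = trans (cong (ℤ._+ ℤ.- (+ P ℤ.* + (K * K) ℤ.* + M))
      (trans (ℤ.pos-+ (e * (K * K * q)) (P * (K * K) * M))
        (cong₂ ℤ._+_ (trans (ℤ.pos-* e (K * K * q)) (cong (λ z → + e ℤ.* + z) (sym (*-identityʳ (K * K * q)))))
          (trans (ℤ.pos-* (P * (K * K)) M) (cong (ℤ._* + M) (ℤ.pos-* P (K * K)))))))
    (cancel (+ e ℤ.* + (K * K * q * 1)) (+ P ℤ.* + (K * K) ℤ.* + M))
    where
    cancel : ∀ x y → (x ℤ.+ y) ℤ.+ ℤ.- y ≡ x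
    cancel = ℤSolver.solve-∀

-- From edge density to `EdgeDense` for large `n`

2*nC2+n : ∀ n → 2 * (n C 2) + n ≡ n * n
2*nC2+n zero = refl
2*nC2+n (suc n) = begin
  2 * (suc n C 2) + suc n              ≡⟨ cong (λ z → 2 * z + suc n) (sym (nCk+nC[k+1]≡[n+1]C[k+1] n 1)) ⟩
  2 * (n C 1 + n C 2) + suc n          ≡⟨ cong (λ z → 2 * (z + n C 2) + suc n) (nC1≡n n) ⟩
  2 * (n + n C 2) + suc n              ≡⟨ regroup n (n C 2) ⟩
  (2 * (n C 2) + n) + (n + suc n)      ≡⟨ cong (_+ (n + suc n)) (2*nC2+n n) ⟩
  n * n + (n + suc n)                  ≡⟨ square n ⟩
  suc n * suc n ∎
  where
  open ≡-Reasoning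
  regroup : ∀ a c → 2 * (a + c) + suc a ≡ (2 * c + a) + (a + suc a)
  regroup = solve-∀
  square : ∀ a → a * a + (a + suc a) ≡ suc a * suc a
  square = solve-∀

-- Used with `B` = K², `A` = (K-1)² and ε = `suc p` / `q`; the first equation is K² - (K-1)² = 2K -
-- 1. The surplus εn² is quadratic and absorbs two linear losses: the error term in `L`, and the `n`
-- by which `2 * M` falls short of `n * n`.
edge-dense-arith : ∀ B K A q p L n N e M → B + 1 ≡ 2 * K + A → A ≤ B → N + 2 * e ≡ n * n → 2 * M + n ≡ n * n →
  4 * (q * L) + q + 1 ≤ n → (A * q + suc p * B) * M ≤ e * (B * q) →
  q * (B * N + 4 * (B * (L * n)) + n * n) ≤ q * (2 * (K * (n * n)))
edge-dense-arith B K A q p L n N e M B≡ A≤B N≡ M≡ large h =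
  +-cancelʳ-≤ (2 * (e * (B * q)) + R * n) _ _ (begin
  q * (B * N + 4 * (B * (L * n)) + n * n) + (2 * (e * (B * q)) + R * n)
    ≡⟨ e₁ q B N e (B * (L * n)) (n * n) (R * n) ⟩
  q * (B * (N + 2 * e)) + (4 * (q * (B * (L * n))) + R * n) + q * (n * n)
    ≡⟨ cong (λ z → q * (B * z) + (4 * (q * (B * (L * n))) + R * n) + q * (n * n)) N≡ ⟩
  q * (B * (n * n)) + (4 * (q * (B * (L * n))) + R * n) + q * (n * n)
    ≤⟨ +-monoˡ-≤ (q * (n * n)) (+-monoʳ-≤ (q * (B * (n * n))) slack) ⟩
  q * (B * (n * n)) + suc p * B * (n * n) + q * (n * n)
    ≡⟨ e₂ q B (suc p) (n * n) ⟩
  q * ((B + 1) * (n * n)) + suc p * B * (n * n)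
    ≡⟨ cong (λ z → q * (z * (n * n)) + suc p * B * (n * n)) B≡ ⟩
  q * ((2 * K + A) * (n * n)) + suc p * B * (n * n)
    ≡⟨ e₃ q K A (suc p * B) (n * n) ⟩
  q * (2 * (K * (n * n))) + R * (n * n)
    ≡⟨ cong (λ z → q * (2 * (K * (n * n))) + R * z) (sym M≡) ⟩
  q * (2 * (K * (n * n))) + R * (2 * M + n)
    ≡⟨ e₄ (q * (2 * (K * (n * n)))) R M n ⟩
  q * (2 * (K * (n * n))) + (2 * (R * M) + R * n)
    ≤⟨ +-monoʳ-≤ (q * (2 * (K * (n * n)))) (+-monoˡ-≤ (R * n) (*-monoʳ-≤ 2 h)) ⟩
  q * (2 * (K * (n * n))) + (2 * (e * (B * q)) + R * n) ∎)
  where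
  open ≤-Reasoning
  R : ℕ
  R = A * q + suc p * B

  -- Per factor `B * n` the loss is at most `4 * (q * L) + q + suc p` and the gain is `suc p * n`.
  -- The threshold settles `p` = 0, and each further unit of `p` needs only `1 ≤ n`.
  slack : 4 * (q * (B * (L * n))) + R * n ≤ suc p * B * (n * n)
  slack = begin
    4 * (q * (B * (L * n))) + R * n
      ≤⟨ +-monoʳ-≤ (4 * (q * (B * (L * n)))) (*-monoˡ-≤ n (+-monoˡ-≤ (suc p * B) (*-monoˡ-≤ q A≤B))) ⟩
    4 * (q * (B * (L * n))) + (B * q + suc p * B) * n
      ≡⟨ s₁ q B L n p ⟩
    B * n * ((4 * (q * L) + q + 1) + p * 1)
      ≤⟨ *-monoʳ-≤ (B * n) (+-mono-≤ large (*-monoʳ-≤ p (≤-trans (m≤n+m 1 (4 * (q * L) + q)) large))) ⟩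
    B * n * (n + p * n)
      ≡⟨ s₂ B n p ⟩
    suc p * B * (n * n) ∎
    where
    s₁ : ∀ q B L n p → 4 * (q * (B * (L * n))) + (B * q + suc p * B) * n ≡ B * n * ((4 * (q * L) + q + 1) + p * 1)
    s₁ = solve-∀
    s₂ : ∀ B n p → B * n * (n + p * n) ≡ suc p * B * (n * n)
    s₂ = solve-∀

  e₁ : ∀ q B N e x y z → q * (B * N + 4 * x + y) + (2 * (e * (B * q)) + z) ≡ q * (B * (N + 2 * e)) + (4 * (q * x) + z) + q * y
  e₁ = solve-∀
  e₂ : ∀ q B P s → q * (B * s) + P * B * s + q * s ≡ q * ((B + 1) * s) + P * B * s
  e₂ = solve-∀
  e₃ : ∀ q K A x s → q * ((2 * K + A) * s) + x * s ≡ q * (2 * (K * s)) + (A * q + x) * s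
  e₃ = solve-∀
  e₄ : ∀ x a c n → x + a * (2 * c + n) ≡ x + (2 * (a * c) + a * n)
  e₄ = solve-∀

edge-dense : ∀ k p d L (G : SimpleGraph n) → 4 * (suc d * L) + suc d + 1 ≤ n →
  (k * k * suc d + suc p * (suc k * suc k)) * (n C 2) ≤ edgeCount G * (suc k * suc k * suc d) →
  EdgeDense (suc k) L G
edge-dense {n} k p d L G large h = *-cancelˡ-≤ (suc d)
  (edge-dense-arith (suc k * suc k) (suc k) (k * k) (suc d) p L n (nonedges G Full) (edgeCount G) (n C 2)
    (square k) (*-mono-≤ (n≤1+n k) (n≤1+n k)) complement (2*nC2+n n) large h)
  where
  square : ∀ k → suc k * suc k + 1 ≡ 2 * suc k + k * k
  square = solve-∀
  complement : nonedges G Full + 2 * edgeCount G ≡ n * n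
  complement = trans (cong (λ z → nonedges G Full + z) (sym (handshake G)))
    (trans (+-comm (nonedges G Full) _) (trans (∑∑-complement Full (adj G)) (cong₂ _*_ (∣∣-full n) (∣∣-full n))))

-- `RainbowFree` is a negation, so the sparse colour is found by deciding the bound for each colour;
-- if all fail, every graph is `EdgeDense` and a rainbow copy exists.
atMost : (T : SimpleGraph m) → IsTree T → edgeCount T ≡ suc k → ∀ p d {ε} → ℚ.toℚᵘ ε ≡ mkℚᵘ (+ suc p) d → ∀ n →
  4 * (suc d * suc m) + suc d + 1 ≤ n → ExAtMost (suc k) n T (starDensity (suc k) ℚ.+ ε)
atMost {m} {k} T tree edges p d {ε} ε≡ n large 𝒢 free = decide (Fin.any? Sparse?)
  where
  bound : ℚ
  bound = (starDensity (suc k) ℚ.+ ε) ℚ.* toℚ (n C 2)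
  Sparse : Fin (suc k) → Set
  Sparse i = toℚ (edgeCount (𝒢 i)) ℚ.≤ bound
  Sparse? : ∀ i → Dec (Sparse i)
  Sparse? i = toℚ (edgeCount (𝒢 i)) ℚ.≤? bound
  dense : ∀ i → ¬ Sparse i → EdgeDense (suc k) (suc m) (𝒢 i)
  dense i ¬sparse = edge-dense k p d (suc m) (𝒢 i) large
    (<⇒≤ (≰⇒> λ le → ¬sparse (≤-density+ε k p d ε≡ (edgeCount (𝒢 i)) (n C 2) le)))
  decide : Dec (∃[ i ] Sparse i) → ∃[ i ] Sparse i
  decide (yes r) = r
  decide (no none) = contradiction
    (rainbow-tree T tree edges 𝒢 (≤-trans (m≤n+m 1 (4 * (suc d * suc m) + suc d)) large) λ i → dense i λ sparse → none (i , sparse)) free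

-- Stars

∣∣-complement : (P : Fin n → Bool) → ∣ P ∣ + ∣ (λ v → not (P v)) ∣ ≡ n
∣∣-complement {n} P = trans (sym (∑-distrib-+ (λ v → ⟦ P v ⟧) (λ v → ⟦ not (P v) ⟧)))
  (trans (sum-cong-≗ {n} λ v → both (P v)) (∣∣-full n))
  where
  both : ∀ b → ⟦ b ⟧ + ⟦ not b ⟧ ≡ 1
  both true = refl
  both false = refl

∣∣≤1 : (P : Fin n → Bool) → (∀ i j → P i ≡ true → P j ≡ true → i ≡ j) → ∣ P ∣ ≤ 1
∣∣≤1 {n} P same with Fin.any? (λ i → P i Bool.≟ true)
... | yes (i , Pi) = ≤-reflexive (∣∣-unique P Pi λ j Pj → same j i Pj Pi)
... | no none = ≤-trans (≤-reflexive (sum-zero {n} λ i → cong ⟦_⟧ (≢true⇒false λ e → none (i , e)))) z≤n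

∣∣-injection : ∀ {q} (P : Fin n → Bool) (g : Fin n → Fin q) →
  (∀ i j → P i ≡ true → P j ≡ true → g i ≡ g j → i ≡ j) → ∣ P ∣ ≤ q
∣∣-injection {n} {q} P g inj = begin
  ∣ P ∣                                          ≡⟨ sum-cong-≗ {n} (λ i → spread (P i) (g i)) ⟩
  ∑[ i < n ] ∑[ t < q ] ⟦ P i ∧ (t == g i) ⟧     ≡⟨ ∑-comm {n} {q} (λ i t → ⟦ P i ∧ (t == g i) ⟧) ⟩
  ∑[ t < q ] ∣ (λ i → P i ∧ (t == g i)) ∣        ≤⟨ sum-mono-≤ (λ t → ∣∣≤1 (λ i → P i ∧ (t == g i)) (fibre t)) ⟩
  ∑[ t < q ] 1                                   ≡⟨ ∣∣-full q ⟩
  q ∎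
  where
  open ≤-Reasoning
  spread : ∀ b s → ⟦ b ⟧ ≡ ∑[ t < q ] ⟦ b ∧ (t == s) ⟧
  spread true s = sym (∣∣-singleton s)
  spread false s = sym (sum-zero {q} λ _ → refl)
  ∧-elim : ∀ b {c} → b ∧ c ≡ true → b ≡ true × c ≡ true
  ∧-elim true e = refl , e
  fibre : ∀ t i j → P i ∧ (t == g i) ≡ true → P j ∧ (t == g j) ≡ true → i ≡ j
  fibre t i j ei ej with ∧-elim (P i) ei | ∧-elim (P j) ej
  ... | Pi , ti | Pj , tj = inj i j Pi Pj (trans (sym (==⇒≡ {i = t} {g i} ti)) (==⇒≡ {i = t} {g j} tj))

clique : (Fin n → Bool) → SimpleGraph n
clique W = record
  { adj = λ u v → not (u == v) ∧ (W u ∧ W v)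
  ; sym = λ u v → symmetric u v
  ; irrefl = λ u → cong (λ b → not b ∧ (W u ∧ W u)) (==-refl u)
  }
  where
  symmetric : ∀ u v → not (u == v) ∧ (W u ∧ W v) ≡ not (v == u) ∧ (W v ∧ W u)
  symmetric u v with u Fin.≟ v | v Fin.≟ u
  ... | yes _ | yes _ = refl
  ... | yes p | no ¬p = contradiction (sym p) ¬p
  ... | no ¬p | yes p = contradiction (sym p) ¬p
  ... | no _ | no _ = ∧-comm (W u) (W v)

clique-edges : (W : Fin n → Bool) → 2 * edgeCount (clique W) + ∣ W ∣ ≡ ∣ W ∣ * ∣ W ∣
clique-edges {n} W = begin
  2 * edgeCount (clique W) + ∣ W ∣
    ≡⟨ cong (_+ ∣ W ∣) (sym (handshake (clique W))) ⟩
  ∑∑ Full (adj (clique W)) + ∣ W ∣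
    ≡⟨ sym (∑-distrib-+ {n} (λ u → ⟦ Full u ⟧ * row Full (adj (clique W)) u) (λ u → ⟦ W u ⟧)) ⟩
  ∑[ u < n ] (1 * row Full (adj (clique W)) u + ⟦ W u ⟧)
    ≡⟨ sum-cong-≗ {n} rows ⟩
  ∑[ u < n ] (⟦ W u ⟧ * ∣ W ∣)
    ≡⟨ sym (*-distribʳ-sum {n} ∣ W ∣ (λ u → ⟦ W u ⟧)) ⟩
  ∣ W ∣ * ∣ W ∣ ∎
  where
  open ≡-Reasoning
  point : ∀ u v → 1 * ⟦ adj (clique W) u v ⟧ + ⟦ v == u ⟧ * ⟦ W u ⟧ ≡ ⟦ W u ⟧ * ⟦ W v ⟧
  point u v with u Fin.≟ v | v Fin.≟ u
  ... | yes p | no ¬p = contradiction (sym p) ¬p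
  ... | no ¬p | yes p = contradiction (sym p) ¬p
  ... | yes refl | yes _ with W u
  ...   | true = refl
  ...   | false = refl
  point u v | no _ | no _ with W u | W v
  ...   | true | true = refl
  ...   | true | false = refl
  ...   | false | _ = refl
  rows : ∀ u → 1 * row Full (adj (clique W)) u + ⟦ W u ⟧ ≡ ⟦ W u ⟧ * ∣ W ∣
  rows u = begin
    1 * row Full (adj (clique W)) u + ⟦ W u ⟧
      ≡⟨ cong₂ _+_ (+-identityʳ (row Full (adj (clique W)) u)) (sym (sum-pick u (λ _ → ⟦ W u ⟧))) ⟩
    row Full (adj (clique W)) u + ∑[ v < n ] (⟦ v == u ⟧ * ⟦ W u ⟧)
      ≡⟨ sym (∑-distrib-+ {n} (λ v → 1 * ⟦ adj (clique W) u v ⟧) (λ v → ⟦ v == u ⟧ * ⟦ W u ⟧)) ⟩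
    ∑[ v < n ] (1 * ⟦ adj (clique W) u v ⟧ + ⟦ v == u ⟧ * ⟦ W u ⟧)
      ≡⟨ sum-cong-≗ {n} (point u) ⟩
    ∑[ v < n ] (⟦ W u ⟧ * ⟦ W v ⟧)
      ≡⟨ sym (*-distribˡ-sum {n} ⟦ W u ⟧ (λ v → ⟦ W v ⟧)) ⟩
    ⟦ W u ⟧ * ∣ W ∣ ∎

part : ∀ k → Fin n → Fin (suc k)
part k u = toℕ u mod suc k

outside : ∀ k → Fin (suc k) → Fin n → Bool
outside k i u = not (part k u == i)

-- Within a residue class the quotient by `K` determines the vertex and takes at most `n / K + 1`
-- values.
part-small : ∀ n k (i : Fin (suc k)) → suc k * ∣ (λ (u : Fin n) → part k u == i) ∣ ≤ n + suc k
part-small n k i = begin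
  K * ∣ (λ (u : Fin n) → part k u == i) ∣   ≤⟨ *-monoʳ-≤ K (∣∣-injection (λ (u : Fin n) → part k u == i) quotient injective) ⟩
  K * suc (n / K)                 ≡⟨ trans (*-suc K (n / K)) (+-comm K (K * (n / K))) ⟩
  K * (n / K) + K                 ≤⟨ +-monoˡ-≤ K (≤-trans (≤-reflexive (*-comm K (n / K))) (m/n*n≤m n K)) ⟩
  n + K ∎
  where
  open ≤-Reasoning
  K : ℕ
  K = suc k
  quotient : Fin n → Fin (suc (n / K))
  quotient u = fromℕ< (s≤s (/-mono-≤ (<⇒≤ (Fin.toℕ<n u)) (≤-refl {K})))
  quotient≡ : ∀ u → toℕ (quotient u) ≡ toℕ u / K
  quotient≡ u = Fin.toℕ-fromℕ< (s≤s (/-mono-≤ (<⇒≤ (Fin.toℕ<n u)) (≤-refl {K})))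
  remainder≡ : ∀ u → part k u == i ≡ true → toℕ u % K ≡ toℕ i
  remainder≡ u e = trans (sym (Fin.toℕ-fromℕ< (m%n<n (toℕ u) K))) (cong toℕ (==⇒≡ {i = part k u} {i} e))
  injective : ∀ u v → part k u == i ≡ true → part k v == i ≡ true → quotient u ≡ quotient v → u ≡ v
  injective u v eu ev eq = Fin.toℕ-injective
    (trans (m≡m%n+[m/n]*n (toℕ u) K) (trans (cong₂ (λ r s → r + s * K)
      (trans (remainder≡ u eu) (sym (remainder≡ v ev)))
      (trans (sym (quotient≡ u)) (trans (cong toℕ eq) (quotient≡ v)))) (sym (m≡m%n+[m/n]*n (toℕ v) K))))

-- The centre lies in some part, and in the colour of that part it is isolated. The `suc k` edges
-- would thus need distinct colours among the `k` others.
star-free : ∀ k → RainbowFree {suc k} {n} (λ i → clique (outside k i)) (star (suc k))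
star-free k copy = contradiction (Fin.injective⇒≤ {f = λ j → Fin.punchOut (avoids j)} injective) (<⇒≱ (n<1+n k))
  where
  open RainbowCopy copy renaming (φ to place; ψ to colouring)
  centre : Fin (suc k)
  centre = part k (place Fin.zero)
  colour : Fin (suc k) → Fin (suc k)
  colour j = colouring Fin.zero (Fin.suc j)
  not-adjacent : ∀ i x → part k (place Fin.zero) ≡ i → adj (clique (outside k i)) (place Fin.zero) x ≡ false
  not-adjacent i x refl rewrite ==-refl centre with place Fin.zero == x
  ... | true = refl
  ... | false = refl
  avoids : ∀ j → centre ≢ colour j
  avoids j eq = true≢false (ψ-ok Fin.zero (Fin.suc j) (s≤s z≤n) refl) (not-adjacent (colour j) _ eq)
  injective : ∀ {i j} → Fin.punchOut (avoids i) ≡ Fin.punchOut (avoids j) → i ≡ j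
  injective {i} {j} eq = Fin.suc-injective (proj₂ (ψ-inj Fin.zero (Fin.suc i) Fin.zero (Fin.suc j)
    (s≤s z≤n) refl (s≤s z≤n) refl (Fin.punchOut-injective (avoids i) (avoids j) eq)))

-- With K = `suc k`, each clique has at least kn/K - 1 vertices, which costs at most 4n ordered
-- pairs against κ²n². The bound `4 * suc d + 1 ≤ n` makes that less than the ε allowance.
atLeast : ∀ k p d {ε} → ℚ.toℚᵘ ε ≡ mkℚᵘ (+ suc p) d → ∀ n → 4 * suc d + 1 ≤ n →
  ExAtLeast (suc k) n (star (suc k)) (starDensity (suc k) ℚ.- ε)
atLeast k p d ε≡ n large = (λ i → clique (outside k i)) , star-free k ,
  λ i → density-ε≤ k p d ε≡ (e i) (n C 2) (enough i)
  where
  open ≤-Reasoning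
  K q P : ℕ
  K = suc k
  q = suc d
  P = suc p
  module _ (i : Fin K) where
    w b e : ℕ
    w = ∣ outside {n} k i ∣
    b = ∣ (λ (u : Fin n) → part k u == i) ∣
    e = edgeCount (clique (outside {n} k i))

    w-large : k * n ≤ K * (w + 1)
    w-large = +-cancelˡ-≤ n _ _ (begin
      n + k * n            ≡⟨ cong (K *_) (sym (∣∣-complement (λ (u : Fin n) → part k u == i))) ⟩
      K * (b + w)          ≡⟨ *-distribˡ-+ K b w ⟩
      K * b + K * w        ≤⟨ +-monoˡ-≤ (K * w) (part-small n k i) ⟩
      n + K + K * w        ≡⟨ regroup n K w ⟩
      n + K * (w + 1) ∎)
      where
      regroup : ∀ n K w → n + K + K * w ≡ n + K * (w + 1)
      regroup = solve-∀

    quadratic : k * k * (n * n) ≤ 2 * (K * K * e) + K * K * (4 * n)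
    quadratic = begin
      k * k * (n * n)                         ≡⟨ square k n ⟩
      (k * n) * (k * n)                       ≤⟨ *-mono-≤ w-large w-large ⟩
      (K * (w + 1)) * (K * (w + 1))           ≡⟨ expand K w ⟩
      K * K * (w * w) + K * K * (2 * w + 1)   ≡⟨ cong (λ z → K * K * z + K * K * (2 * w + 1)) (sym (clique-edges (outside {n} k i))) ⟩
      K * K * (2 * e + w) + K * K * (2 * w + 1) ≡⟨ collect (K * K) e w ⟩
      2 * (K * K * e) + K * K * (3 * w + 1)   ≤⟨ +-monoʳ-≤ (2 * (K * K * e)) (*-monoʳ-≤ (K * K) (+-mono-≤ (*-monoʳ-≤ 3 (∣∣≤n (outside {n} k i))) (≤-trans (m≤n+m 1 (4 * q)) large))) ⟩
      2 * (K * K * e) + K * K * (3 * n + n)   ≡⟨ cong (λ z → 2 * (K * K * e) + K * K * z) (four n) ⟩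
      2 * (K * K * e) + K * K * (4 * n) ∎
      where
      square : ∀ a x → a * a * (x * x) ≡ (a * x) * (a * x)
      square = solve-∀
      expand : ∀ a w → (a * (w + 1)) * (a * (w + 1)) ≡ a * a * (w * w) + a * a * (2 * w + 1)
      expand = solve-∀
      collect : ∀ a e w → a * (2 * e + w) + a * (2 * w + 1) ≡ 2 * (a * e) + a * (3 * w + 1)
      collect = solve-∀
      four : ∀ x → 3 * x + x ≡ 4 * x
      four = solve-∀

    slack : q * (4 * n) ≤ P * (2 * (n C 2))
    slack = +-cancelʳ-≤ n _ _ (begin
      q * (4 * n) + n               ≡⟨ factor q n ⟩
      (4 * q + 1) * n               ≤⟨ *-monoˡ-≤ n large ⟩
      n * n                         ≡⟨ sym (2*nC2+n n) ⟩
      2 * (n C 2) + n               ≤⟨ +-monoˡ-≤ n (m≤n*m (2 * (n C 2)) P) ⟩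
      P * (2 * (n C 2)) + n ∎)
      where
      factor : ∀ q n → q * (4 * n) + n ≡ (4 * q + 1) * n
      factor = solve-∀

    enough : k * k * q * (n C 2) ≤ e * (K * K * q) + P * (K * K) * (n C 2)
    enough = *-cancelˡ-≤ 2 (begin
      2 * (k * k * q * (n C 2))                      ≤⟨ m≤m+n _ (k * k * q * n) ⟩
      2 * (k * k * q * (n C 2)) + k * k * q * n      ≡⟨ f₁ (k * k) q (n C 2) n ⟩
      q * (k * k * (2 * (n C 2) + n))                ≡⟨ cong (λ z → q * (k * k * z)) (2*nC2+n n) ⟩
      q * (k * k * (n * n))                          ≤⟨ *-monoʳ-≤ q quadratic ⟩
      q * (2 * (K * K * e) + K * K * (4 * n))        ≡⟨ f₂ q (K * K) e n ⟩
      2 * (e * (K * K * q)) + K * K * (q * (4 * n))  ≤⟨ +-monoʳ-≤ (2 * (e * (K * K * q))) (*-monoʳ-≤ (K * K) slack) ⟩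
      2 * (e * (K * K * q)) + K * K * (P * (2 * (n C 2))) ≡⟨ f₃ (e * (K * K * q)) (K * K) P (n C 2) ⟩
      2 * (e * (K * K * q) + P * (K * K) * (n C 2)) ∎)
      where
      f₁ : ∀ a q c n → 2 * (a * q * c) + a * q * n ≡ q * (a * (2 * c + n))
      f₁ = solve-∀
      f₂ : ∀ q a e n → q * (2 * (a * e) + a * (4 * n)) ≡ 2 * (e * (a * q)) + a * (q * (4 * n))
      f₂ = solve-∀
      f₃ : ∀ x a p c → 2 * x + a * (p * (2 * c)) ≡ 2 * (x + p * a * c)
      f₃ = solve-∀

-- The star as a tree, and the conclusion

star-tree : ∀ k → IsTree (star k)
star-tree k = connected , acyclic
  where
  connected : Connected (star k)
  connected Fin.zero Fin.zero = here
  connected Fin.zero (Fin.suc v) = step refl here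
  connected (Fin.suc u) Fin.zero = step refl here
  connected (Fin.suc u) (Fin.suc v) = step {v = Fin.zero} refl (step refl here)

  exactly-one : ∀ {u v : Fin (suc k)} → u ∼[ star k ] v → (u ≡ Fin.zero × v ≢ Fin.zero) ⊎ (u ≢ Fin.zero × v ≡ Fin.zero)
  exactly-one {Fin.zero} {Fin.suc _} _ = inj₁ (refl , λ ())
  exactly-one {Fin.suc _} {Fin.zero} _ = inj₂ ((λ ()) , refl)

  -- Every edge contains the centre. The first two edges of a cycle share only the second vertex,
  -- and the closing edge avoids it.
  acyclic : Acyclic (star k)
  acyclic cyc with exactly-one (Cycle.f-adj cyc Fin.zero) | exactly-one (Cycle.f-adj cyc (Fin.suc Fin.zero))
  ... | inj₁ (f0 , f1) | inj₁ (f1′ , _) = f1 f1′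
  ... | inj₁ (f0 , _) | inj₂ (_ , f2) = contradiction (Cycle.f-inj cyc (trans f0 (sym f2))) λ ()
  ... | inj₂ (_ , f1) | inj₂ (f1′ , _) = f1′ f1
  ... | inj₂ (f0 , f1) | inj₁ _ with exactly-one (Cycle.f-close cyc)
  ...   | inj₁ (last , _) = contradiction (Cycle.f-inj cyc (trans last (sym f1))) λ ()
  ...   | inj₂ (_ , f0′) = f0 f0′

star-edges : ∀ k → edgeCount (star k) ≡ k
star-edges k = *-cancelˡ-≡ (edgeCount (star k)) k 2 (begin
  2 * edgeCount (star k)          ≡⟨ sym (handshake (star k)) ⟩
  ∑∑ Full (adj (star k))          ≡⟨ cong₂ _+_ (trans (+-identityʳ _) (∣∣-full k)) (trans (sum-cong-≗ {k} leaf) (∣∣-full k)) ⟩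
  k + k                           ≡⟨ cong (λ z → k + z) (sym (+-identityʳ k)) ⟩
  2 * k ∎)
  where
  open ≡-Reasoning
  leaf : ∀ u → 1 * row Full (adj (star k)) (Fin.suc u) ≡ 1
  leaf u = trans (+-identityʳ _) (cong suc (sum-zero {k} λ _ → refl))

theorem1p3 : (k : ℕ) → .{{_ : NonZero k}} → (m : ℕ) → (T : SimpleGraph m) →
    IsTree T → edgeCount T ≡ k →
    TuranDensityAtMost k T (starDensity k) × TuranDensityEq k (star k) (starDensity k)
theorem1p3 (suc k) m T tree edges = upper , exact
  where
  upper : TuranDensityAtMost (suc k) T (starDensity (suc k))
  upper (mkℚ (+ suc p) d _) _ = 4 * (suc d * suc m) + suc d + 1 , atMost T tree edges p d refl
  upper (mkℚ (+ zero) d _) (ℚ.*<* (ℤ.+<+ ()))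
  upper (mkℚ ℤ.-[1+ p ] d _) (ℚ.*<* ())
  exact : TuranDensityEq (suc k) (star (suc k)) (starDensity (suc k))
  exact (mkℚ (+ suc p) d _) _ = N₁ + N₂ , λ n large →
    atMost (star (suc k)) (star-tree (suc k)) (star-edges (suc k)) p d refl n (≤-trans (m≤m+n N₁ N₂) large) ,
    atLeast k p d refl n (≤-trans (m≤n+m N₂ N₁) large)
    where
    N₁ N₂ : ℕ
    -- The star with `suc k` edges has `suc (suc k)` vertices, and the degree threshold is one more.
    N₁ = 4 * (suc d * suc (suc (suc k))) + suc d + 1
    N₂ = 4 * suc d + 1
  exact (mkℚ (+ zero) d _) (ℚ.*<* (ℤ.+<+ ()))
  exact (mkℚ ℤ.-[1+ p ] d _) (ℚ.*<* ())
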